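{- Let $r\ge 3$ be an integer and let $G$ be a connected $r$-regular graph of order $n$. (i) If $G$ is not (isomorphic to) the incidence graph of a projective plane of order $r-1$, then $$\gamma_{\times (r-1),t}(G)\le \frac{r(r-1)-1}{r(r-1)}\,n .$$ (ii) If $G$ is the incidence graph of a projective plane of order $r-1$ (so $n=2(r(r-1)+1)$), then $$\gamma_{\times (r-1),t}(G)=\frac{r(r-1)}{r(r-1)+1}\,n=2r(r-1).$$
   Context: All graphs are finite and simple. For a vertex $v$ of $G$, $N(v)=\{u\in V(G): uv\in E(G)\}$ is its open neighborhood. For a positive integer $k$, a $k$-tuple total dominating set of $G$ is a set $S\subseteq V(G)$ with $|N(v)\cap S|\ge k$ for every $v\in V(G)$; $\gamma_{\times k,t}(G)$ denotes the minimum cardinality of such a set. A projective plane of order $q$ consists of $q^2+q+1$ points and $q^2+q+1$ lines with an incidence relation such that every line is incident with exactly $q+1$ points, every point with exactly $q+1$ lines, any two distinct points lie on exactly one common line, and any two distinct lines share exactly one common point. Its incidence graph is the bipartite graph whose vertices are the points and the lines, a point being adjacent to a line iff they are incident. -}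

module Defs where

open import Data.Fin.Base using (Fin; splitAt)
open import Data.Fin.Subset using (Subset; _∩_; ∣_∣)
open import Data.Empty using (⊥)
open import Data.Nat.Base using (ℕ; NonZero; _+_; _*_; _∸_; _^_; _≤_; s≤s)
open import Data.Product using (_×_; ∃; ∃!)
open import Data.Sum.Base using (_⊎_; inj₁; inj₂)
open import Data.Vec.Base using (tabulate)
open import Function.Bundles using (_↔_; _⇔_; Inverse)
open import Level using (0ℓ)
open import Relation.Binary.Core using (Rel; REL)
open import Relation.Binary.Definitions
  using (Decidable; Symmetric; Irreflexive)
open import Relation.Binary.Construct.Closure.ReflexiveTransitive using (Star)
open import Relation.Binary.PropositionalEquality.Core using (_≡_; _≢_; refl)
open import Relation.Nullary.Decidable.Core using (no; does)
import Relation.Unary as Unary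

private
  variable
    m n : ℕ

subsetOf : {P : Fin n → Set} → Unary.Decidable P → Subset n
subsetOf P? = tabulate (λ i → does (P? i))

record Graph (n : ℕ) : Set₁ where
  field
    Adj    : Rel (Fin n) 0ℓ
    adj?   : Decidable Adj
    sym    : Symmetric Adj
    irrefl : Irreflexive _≡_ Adj

  N : Fin n → Subset n
  N v = subsetOf (λ u → adj? u v)

open Graph

-- The empty graph is not regarded as connected.
record Connected (G : Graph n) : Set where
  field
    nonEmpty : NonZero n
    path     : ∀ u v → Star (Adj G) u v

Regular : ℕ → Graph n → Set
Regular r G = ∀ v → ∣ N G v ∣ ≡ r

record _≅_ (G : Graph m) (H : Graph n) : Set where
  field
    bijection : Fin m ↔ Fin n
    preserves : ∀ u v →
      Adj G u v ⇔ Adj H (Inverse.to bijection u) (Inverse.to bijection v)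

TupleTotalDominating : ℕ → Graph n → Subset n → Set
TupleTotalDominating k G S = ∀ v → k ≤ ∣ N G v ∩ S ∣

-- A relation rather than a function of G, since no k-tuple total
-- dominating set exists when some vertex has degree less than k.
record IsTupleTotalDominationNumber (k : ℕ) (G : Graph n) (γ : ℕ) : Set where
  field
    attained : ∃ λ S → TupleTotalDominating k G S × ∣ S ∣ ≡ γ
    minimal  : ∀ S → TupleTotalDominating k G S → γ ≤ ∣ S ∣

record ProjectivePlane (q : ℕ) : Set₁ where
  Point = Fin (q ^ 2 + q + 1)
  Line  = Fin (q ^ 2 + q + 1)

  field
    _on_          : REL Point Line 0ℓ
    _on?_         : Decidable _on_
    pointsPerLine : ∀ l → ∣ subsetOf (λ p → p on? l) ∣ ≡ q + 1
    linesPerPoint : ∀ p → ∣ subsetOf (λ l → p on? l) ∣ ≡ q + 1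
    join          : ∀ p p′ → p ≢ p′ → ∃! _≡_ λ l → p on l × p′ on l
    meet          : ∀ l l′ → l ≢ l′ → ∃! _≡_ λ p → p on l × p on l′

-- splitAt reads the first q ^ 2 + q + 1 vertices as the points and the
-- remaining ones as the lines.
incidenceGraph : ∀ {q} → ProjectivePlane q →
                 Graph ((q ^ 2 + q + 1) + (q ^ 2 + q + 1))
incidenceGraph {q} P = record
  { Adj    = λ u v → Incident (splitAt k u) (splitAt k v)
  ; adj?   = λ u v → incident? (splitAt k u) (splitAt k v)
  ; sym    = λ {u} {v} → incident-sym (splitAt k u) (splitAt k v)
  ; irrefl = λ { {u} refl → incident-irrefl (splitAt k u) }
  }
  where
  open ProjectivePlane P

  k : ℕ
  k = q ^ 2 + q + 1

  Incident : Rel (Point ⊎ Line) 0ℓ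
  Incident (inj₁ p) (inj₂ l) = p on l
  Incident (inj₂ l) (inj₁ p) = p on l
  Incident (inj₁ _) (inj₁ _) = ⊥
  Incident (inj₂ _) (inj₂ _) = ⊥

  incident? : Decidable Incident
  incident? (inj₁ p) (inj₂ l) = p on? l
  incident? (inj₂ l) (inj₁ p) = p on? l
  incident? (inj₁ _) (inj₁ _) = no λ ()
  incident? (inj₂ _) (inj₂ _) = no λ ()

  incident-sym : ∀ x y → Incident x y → Incident y x
  incident-sym (inj₁ _) (inj₂ _) i = i
  incident-sym (inj₂ _) (inj₁ _) i = i

  incident-irrefl : ∀ x → Incident x x → ⊥
  incident-irrefl (inj₁ _) ()
  incident-irrefl (inj₂ _) ()

IsIncidenceGraphOfPlane : ℕ → Graph n → Set₁
IsIncidenceGraphOfPlane q G =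
  ∃ λ (P : ProjectivePlane q) → G ≅ incidenceGraph P

r[r∸1]-nonZero : ∀ {r} → 3 ≤ r → NonZero (r * (r ∸ 1))
r[r∸1]-nonZero (s≤s (s≤s (s≤s _))) = _

{-# OPTIONS --safe #-}

-- The complement of an (r - 1)-tuple total dominating set is a set D no two
-- vertices of which have a common neighbour, that is, an independent set of the
-- graph H joining distinct vertices with a common neighbour.  H has maximum degree
-- at most Δ = r (r - 1), and as r ≥ 3 every edge of H lies in a triangle; a Brooks
-- type argument then gives D of size at least n / Δ unless H contains a clique K
-- on Δ + 1 vertices.  In that case counting shows that two vertices of K have
-- exactly one common neighbour, and likewise for the set L of neighbours of K.  By
-- connectedness either K and L are disjoint and G is the incidence graph of a
-- plane with points K and lines L, or K consists of all vertices, which is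
-- impossible by the friendship theorem.  In the incidence graph of a plane, D
-- contains at most one point and at most one line.
module Submission where

import Algebra.Properties.CommutativeSemigroup
import Algebra.Properties.Semiring.Sum
open import Data.Bool.Base using (if_then_else_; true; false)
open import Data.Empty using (⊥-elim)
open import Data.Fin.Base using (Fin; zero; suc; toℕ; inject₁; splitAt; join)
open import Data.Fin.Induction using (<-weakInduction)
open import Data.Fin.Permutation using (↔⇒≡)
open import Data.Fin.Properties as Fin using (any?; all?; _≟_; toℕ<n; splitAt-join; join-splitAt)
open import Data.Fin.Subset
open import Data.Fin.Subset.Properties
import Data.Integer.Base as ℤ
import Data.Integer.Properties as ℤ
open import Data.List.Base using ([]; _∷_)
open import Data.List.Relation.Unary.All using (_∷_)
open import Data.Nat.Base hiding (∣_-_∣; _/_)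
open import Data.Nat.Divisibility
open import Data.Nat.Induction using (Acc; acc; <-wellFounded)
open import Data.Nat.Primality using (Prime; euclidsLemma; ¬prime[0]; ¬prime[1])
open import Data.Nat.Primality.Factorisation using (factorise)
open import Data.Nat.Properties as ℕ hiding (_≟_)
open import Data.Nat.Tactic.RingSolver using (solve-∀)
open import Data.Product using (_×_; _,_; ∃; ∃!; proj₁; proj₂; map)
open import Data.Rational.Base as ℚ using (_/_; toℚᵘ)
import Data.Rational.Properties as ℚ
open import Data.Rational.Unnormalised.Base as ℚᵘ using (mkℚᵘ; *≤*; *≡*)
import Data.Rational.Unnormalised.Properties as ℚᵘ
open import Data.Sum.Base using (_⊎_; inj₁; inj₂; map₁; [_,_]′)
open import Data.Vec.Base as Vec using (Vec; []; _∷_; _∷ʳ_; lookup; replicate; here; there)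
open import Data.Vec.Properties using (map-∷ʳ; map-replicate)
open import Defs
open import Function.Base using (_∘_; _$_; id)
open import Function.Bundles using (_⇔_; Inverse; Equivalence; mk⇔; mk↔ₛ′)
open import Level using (0ℓ)
open import Relation.Binary.Construct.Closure.ReflexiveTransitive using (Star; ε; _◅_)
open import Relation.Binary.Core using (Rel)
open import Relation.Binary.Definitions using (Symmetric; Decidable)
open import Relation.Binary.PropositionalEquality
open import Relation.Nullary
open import Relation.Nullary.Decidable using (map′; _×-dec_; ¬?; decidable-stable)
import Relation.Unary as U

open Algebra.Properties.CommutativeSemigroup +-commutativeSemigroup using (x∙yz≈y∙xz)
open Algebra.Properties.Semiring.Sum +-*-semiring
  using (sum; sum-cong-≗; ∑-distrib-+; ∑-comm; *-distribˡ-sum; *-distribʳ-sum; sum-replicate-zero)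

private variable
  k m n : ℕ

-- Finite sums and cardinalities

𝟙 : {P : Set} → Dec P → ℕ
𝟙 P? = if does P? then 1 else 0

𝟙-yes : {P : Set} (P? : Dec P) → P → 𝟙 P? ≡ 1
𝟙-yes (yes _) _ = refl
𝟙-yes (no ¬p) p = contradiction p ¬p

𝟙-no : {P : Set} (P? : Dec P) → ¬ P → 𝟙 P? ≡ 0
𝟙-no (yes p) ¬p = contradiction p ¬p
𝟙-no (no _)  _  = refl

sum-zero : (f : Fin n → ℕ) → (∀ i → f i ≡ 0) → sum f ≡ 0
sum-zero {n} f f≡0 = trans (sum-cong-≗ f≡0) (sum-replicate-zero n)

sum-const : ∀ n c → sum {n} (λ _ → c) ≡ n * c
sum-const zero    c = refl
sum-const (suc n) c = cong (c +_) (sum-const n c)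

∣-sum : ∀ {d} (f : Fin n → ℕ) → (∀ i → d ∣ f i) → d ∣ sum f
∣-sum {zero}  f d∣f = _ ∣0
∣-sum {suc n} f d∣f = ∣m∣n⇒∣m+n (d∣f zero) (∣-sum (f ∘ suc) (d∣f ∘ suc))

sum-mono-≤ : {f g : Fin n → ℕ} → (∀ i → f i ≤ g i) → sum f ≤ sum g
sum-mono-≤ {zero}  f≤g = z≤n
sum-mono-≤ {suc n} f≤g = +-mono-≤ (f≤g zero) (sum-mono-≤ (f≤g ∘ suc))

-- Slack in one term would survive in the total. This turns one-sided bounds on codegrees into exact
-- values, for a large clique and again for its dual.
sum-squeeze : {f g : Fin n → ℕ} → (∀ i → f i ≤ g i) → sum g ≤ sum f → ∀ i → f i ≡ g i
sum-squeeze {suc n} {f} {g} f≤g g≤f zero = ≤-antisym (f≤g zero)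
  (+-cancelʳ-≤ _ _ _ (≤-trans g≤f (+-monoʳ-≤ (f zero) (sum-mono-≤ (f≤g ∘ suc)))))
sum-squeeze {suc n} {f} {g} f≤g g≤f (suc i) = sum-squeeze (f≤g ∘ suc)
  (+-cancelˡ-≤ _ _ _ (≤-trans g≤f (+-monoˡ-≤ _ (f≤g zero)))) i

term≤sum : ∀ (f : Fin n → ℕ) i → f i ≤ sum f
term≤sum f zero    = m≤m+n (f zero) _
term≤sum f (suc i) = m≤n⇒m≤o+n (f zero) (term≤sum (f ∘ suc) i)

terms≤sum : ∀ (f : Fin n → ℕ) {i j} → i ≢ j → f i + f j ≤ sum f
terms≤sum f {zero}  {zero}  i≢j = contradiction refl i≢j
terms≤sum f {zero}  {suc j} i≢j = +-monoʳ-≤ (f zero) (term≤sum (f ∘ suc) j)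
terms≤sum f {suc i} {zero}  i≢j =
  ≤-trans (≤-reflexive (+-comm (f (suc i)) _)) (+-monoʳ-≤ (f zero) (term≤sum (f ∘ suc) i))
terms≤sum f {suc i} {suc j} i≢j =
  m≤n⇒m≤o+n (f zero) (terms≤sum (f ∘ suc) (i≢j ∘ cong suc))

sum-positive : ∀ (f : Fin n → ℕ) → 0 < sum f → ∃ λ i → 0 < f i
sum-positive {suc n} f 0<sum with f zero in eq
... | suc _ = zero , subst (0 <_) (sym eq) z<s
... | zero  = map suc id (sum-positive (f ∘ suc) 0<sum)

sum-at : ∀ (x : Fin n) (f : Fin n → ℕ) → sum (λ y → 𝟙 (x ≟ y) * f y) ≡ f x
sum-at {suc n} zero    f = trans
  (cong₂ _+_ (+-identityʳ (f zero)) (sum-zero {n} _ λ _ → refl)) (+-identityʳ (f zero))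
sum-at {suc n} (suc x) f = sum-at x (f ∘ suc)

∈-subsetOf⁺ : {P : Fin n → Set} (P? : U.Decidable P) → ∀ {x} → P x → x ∈ subsetOf P?
∈-subsetOf⁺ P? {zero} p with P? zero
... | yes _ = here
... | no ¬p = contradiction p ¬p
∈-subsetOf⁺ P? {suc x} p = there (∈-subsetOf⁺ (P? ∘ suc) p)

∈-subsetOf⁻ : {P : Fin n → Set} (P? : U.Decidable P) → ∀ {x} → x ∈ subsetOf P? → P x
∈-subsetOf⁻ P? {zero} x∈ with P? zero | x∈
... | yes p | _ = p
∈-subsetOf⁻ P? {suc x} (there x∈) = ∈-subsetOf⁻ (P? ∘ suc) x∈

card-split : (p q : Subset n) → ∣ p ∣ ≡ ∣ p ∩ q ∣ + ∣ p ─ q ∣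
card-split []          []          = refl
card-split (false ∷ p) (false ∷ q) = card-split p q
card-split (false ∷ p) (true  ∷ q) = card-split p q
card-split (true  ∷ p) (false ∷ q) = trans (cong suc (card-split p q)) (sym (+-suc _ _))
card-split (true  ∷ p) (true  ∷ q) = cong suc (card-split p q)

x∈p─q⁻ : ∀ (p q : Subset n) {x} → x ∈ p ─ q → x ∈ p × x ∉ q
x∈p─q⁻ (true  ∷ _) (false ∷ _) here = here , λ ()
x∈p─q⁻ (false ∷ _) (true  ∷ _) {zero} ()
x∈p─q⁻ (false ∷ _) (false ∷ _) {zero} ()
x∈p─q⁻ (_     ∷ p) (_     ∷ q) (there x∈) =
  map there (λ x∉q → λ { (there x∈q) → x∉q x∈q }) (x∈p─q⁻ p q x∈)

x∈p⇒0<∣p∣ : ∀ {p : Subset n} {x} → x ∈ p → 0 < ∣ p ∣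
x∈p⇒0<∣p∣ x∈p = ≤-<-trans z≤n (x∈p⇒∣p-x∣<∣p∣ x∈p)

x,y∈p⇒1<∣p∣ : ∀ {p : Subset n} {x y} → x ∈ p → y ∈ p → x ≢ y → 1 < ∣ p ∣
x,y∈p⇒1<∣p∣ x∈p y∈p x≢y =
  ≤-<-trans (x∈p⇒0<∣p∣ (x∈p∧x≢y⇒x∈p-y y∈p (x≢y ∘ sym))) (x∈p⇒∣p-x∣<∣p∣ x∈p)

∣⁅x⁆∪p∣ : ∀ {p : Subset n} {x} → x ∉ p → ∣ ⁅ x ⁆ ∪ p ∣ ≡ suc ∣ p ∣
∣⁅x⁆∪p∣ {p = p} {x} x∉p = begin
  ∣ ⁅ x ⁆ ∪ p ∣
    ≡⟨ card-split (⁅ x ⁆ ∪ p) ⁅ x ⁆ ⟩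
  ∣ (⁅ x ⁆ ∪ p) ∩ ⁅ x ⁆ ∣ + ∣ (⁅ x ⁆ ∪ p) - x ∣
    ≡⟨ cong₂ (λ q q′ → ∣ q ∣ + ∣ q′ ∣)
         (⊆-antisym (p∩q⊆q (⁅ x ⁆ ∪ p) ⁅ x ⁆) (λ y∈ → x∈p∩q⁺ (p⊆p∪q p y∈ , y∈)))
         (⊆-antisym shrink λ y∈p → x∈p∧x≢y⇒x∈p-y (q⊆p∪q ⁅ x ⁆ p y∈p) λ { refl → x∉p y∈p }) ⟩
  ∣ ⁅ x ⁆ ∣ + ∣ p ∣
    ≡⟨ cong (_+ ∣ p ∣) (∣⁅x⁆∣≡1 x) ⟩
  suc ∣ p ∣ ∎
  where
  open ≡-Reasoning
  shrink : (⁅ x ⁆ ∪ p) - x ⊆ p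
  shrink y∈ with x∈p─q⁻ (⁅ x ⁆ ∪ p) ⁅ x ⁆ y∈
  ... | y∈∪ , y∉x = [ (λ y∈x → contradiction y∈x y∉x) , id ]′ (x∈p∪q⁻ ⁅ x ⁆ p y∈∪)

card-subsetOf : {P : Fin n → Set} (P? : U.Decidable P) → ∣ subsetOf P? ∣ ≡ sum λ x → 𝟙 (P? x)
card-subsetOf {zero}  P? = refl
card-subsetOf {suc n} P? with P? zero
... | yes _ = cong suc (card-subsetOf (P? ∘ suc))
... | no  _ = card-subsetOf (P? ∘ suc)

card-sum : (p : Subset n) → ∣ p ∣ ≡ sum λ x → 𝟙 (x ∈? p)
card-sum []          = refl
card-sum (true  ∷ p) = cong suc (card-sum p)
card-sum (false ∷ p) = card-sum p

∣p∣≤1+∣p-x∣ : ∀ (p : Subset n) x → ∣ p ∣ ≤ suc ∣ p - x ∣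
∣p∣≤1+∣p-x∣ p x = begin
  ∣ p ∣                       ≡⟨ card-split p ⁅ x ⁆ ⟩
  ∣ p ∩ ⁅ x ⁆ ∣ + ∣ p - x ∣   ≤⟨ +-monoˡ-≤ ∣ p - x ∣ (∣p∩q∣≤∣q∣ p ⁅ x ⁆) ⟩
  ∣ ⁅ x ⁆ ∣ + ∣ p - x ∣       ≡⟨ cong (_+ ∣ p - x ∣) (∣⁅x⁆∣≡1 x) ⟩
  suc ∣ p - x ∣               ∎
  where open ≤-Reasoning

0<∣p∣⇒nonempty : ∀ {p : Subset n} → 0 < ∣ p ∣ → Nonempty p
0<∣p∣⇒nonempty {n} {p} 0<p = decidable-stable (nonempty? p) λ empty →
  <⇒≢ 0<p (sym (trans (cong ∣_∣ (Empty-unique empty)) (∣⊥∣≡0 n)))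

third-element : ∀ {p : Subset n} → 2 < ∣ p ∣ → ∀ x y → ∃ λ z → z ∈ p × z ≢ x × z ≢ y
third-element {p = p} 2<p x y
  with 0<∣p∣⇒nonempty (s≤s⁻¹ (s≤s⁻¹ (≤-trans 2<p
         (≤-trans (∣p∣≤1+∣p-x∣ p x) (s≤s (∣p∣≤1+∣p-x∣ (p - x) y))))))
... | z , z∈ with x∈p─q⁻ (p - x) ⁅ y ⁆ z∈
...   | z∈p-x , z∉y with x∈p─q⁻ p ⁅ x ⁆ z∈p-x
...     | z∈p , z∉x = z , z∈p , (λ { refl → z∉x (x∈⁅x⁆ z) }) , (λ { refl → z∉y (x∈⁅x⁆ z) })

subsingleton⇒∣p∣≤1 : ∀ {p : Subset n} → (∀ {x y} → x ∈ p → y ∈ p → x ≡ y) → ∣ p ∣ ≤ 1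
subsingleton⇒∣p∣≤1 {n} {p} same with nonempty? p
... | no empty = ≤-trans (≤-reflexive (trans (cong ∣_∣ (Empty-unique empty)) (∣⊥∣≡0 n))) z≤n
... | yes (x , x∈p) = ≤-trans
  (p⊆q⇒∣p∣≤∣q∣ λ {y} y∈p → subst (_∈ ⁅ x ⁆) (same x∈p y∈p) (x∈⁅x⁆ x))
  (≤-reflexive (∣⁅x⁆∣≡1 x))

-- The size `k` is a parameter of its own, so that an enumeration can be transported along an
-- equation for the cardinality; `sum-to` carries counts over all vertices to counts over indices.
record Enumeration (p : Subset n) (k : ℕ) : Set where
  field
    to           : Fin k → Fin n
    to-∈         : ∀ i → to i ∈ p
    to-injective : ∀ {i j} → to i ≡ to j → i ≡ j
    index        : ∀ {x} → x ∈ p → Fin k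
    to-index     : ∀ {x} (x∈p : x ∈ p) → to (index x∈p) ≡ x
    sum-to       : ∀ f → sum (f ∘ to) ≡ sum (λ x → 𝟙 (x ∈? p) * f x)

  index-to : ∀ {i} (to∈p : to i ∈ p) → index to∈p ≡ i
  index-to to∈p = to-injective (to-index to∈p)

open Enumeration

enumerate : (p : Subset n) → Enumeration p ∣ p ∣
enumerate []          = record
  { to           = λ ()
  ; to-∈         = λ ()
  ; to-injective = λ {}
  ; index        = λ ()
  ; to-index     = λ ()
  ; sum-to       = λ _ → refl
  }
enumerate (false ∷ p) = record
  { to           = suc ∘ to e
  ; to-∈         = there ∘ to-∈ e
  ; to-injective = to-injective e ∘ Fin.suc-injective
  ; index        = λ { (there x∈p) → index e x∈p }
  ; to-index     = λ { (there x∈p) → cong suc (to-index e x∈p) }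
  ; sum-to       = λ f → sum-to e (f ∘ suc)
  }
  where e = enumerate p
enumerate (true ∷ p) = record
  { to           = λ { zero → zero ; (suc i) → suc (to e i) }
  ; to-∈         = λ { zero → here ; (suc i) → there (to-∈ e i) }
  ; to-injective = λ { {zero} {zero} _ → refl
                     ; {suc i} {suc j} eq → cong suc (to-injective e (Fin.suc-injective eq)) }
  ; index        = λ { here → zero ; (there x∈p) → suc (index e x∈p) }
  ; to-index     = λ { here → refl ; (there x∈p) → cong suc (to-index e x∈p) }
  ; sum-to       = λ f → cong₂ _+_ (sym (+-identityʳ (f zero))) (sum-to e (f ∘ suc))
  }
  where e = enumerate p

-- Words invariant under rotation and the friendship theorem

Σᵛ : (Vec (Fin n) k → ℕ) → ℕ
Σᵛ {k = zero}  F = F []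
Σᵛ {k = suc k} F = sum λ x → Σᵛ λ xs → F (x ∷ xs)

Σᵛ-cong : {F G : Vec (Fin n) k → ℕ} → (∀ xs → F xs ≡ G xs) → Σᵛ F ≡ Σᵛ G
Σᵛ-cong {k = zero}  F≗G = F≗G []
Σᵛ-cong {k = suc k} F≗G = sum-cong-≗ λ x → Σᵛ-cong λ xs → F≗G (x ∷ xs)

Σᵛ-zero : (F : Vec (Fin n) k → ℕ) → (∀ xs → F xs ≡ 0) → Σᵛ F ≡ 0
Σᵛ-zero {k = zero}  F F≡0 = F≡0 []
Σᵛ-zero {k = suc k} F F≡0 = sum-zero _ λ x → Σᵛ-zero _ λ xs → F≡0 (x ∷ xs)

Σᵛ-*ˡ : ∀ c (F : Vec (Fin n) k → ℕ) → c * Σᵛ F ≡ Σᵛ (λ xs → c * F xs)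
Σᵛ-*ˡ {k = zero}  c F = refl
Σᵛ-*ˡ {k = suc k} c F =
  trans (*-distribˡ-sum c (λ x → Σᵛ λ xs → F (x ∷ xs)))
        (sum-cong-≗ λ x → Σᵛ-*ˡ c λ xs → F (x ∷ xs))

Σᵛ-comm : (F : Fin m → Vec (Fin n) k → ℕ) →
          sum (λ i → Σᵛ (F i)) ≡ Σᵛ (λ xs → sum λ i → F i xs)
Σᵛ-comm {k = zero}  F = refl
Σᵛ-comm {k = suc k} F =
  trans (∑-comm λ i x → Σᵛ λ xs → F i (x ∷ xs))
        (sum-cong-≗ λ x → Σᵛ-comm λ i xs → F i (x ∷ xs))

rotate : Vec (Fin n) (suc k) → Vec (Fin n) (suc k)
rotate (x ∷ xs) = xs ∷ʳ x

-- Rotation permutes the words: exchanging two sums moves the first letter past the second, and the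
-- induction moves it past the others.
Σᵛ-rotate : (F : Vec (Fin n) (suc k) → ℕ) → Σᵛ (F ∘ rotate) ≡ Σᵛ F
Σᵛ-rotate {k = zero}  F = refl
Σᵛ-rotate {k = suc k} F = begin
  (sum λ x → sum λ y → Σᵛ λ xs → F (y ∷ (xs ∷ʳ x)))
    ≡⟨ ∑-comm (λ x y → Σᵛ λ xs → F (y ∷ (xs ∷ʳ x))) ⟩
  (sum λ y → sum λ x → Σᵛ λ xs → F (y ∷ (xs ∷ʳ x)))
    ≡⟨ sum-cong-≗ (λ y → Σᵛ-rotate λ xs → F (y ∷ xs)) ⟩
  (sum λ y → Σᵛ λ xs → F (y ∷ xs)) ∎
  where open ≡-Reasoning

isZero : Fin n → ℕ
isZero zero    = 1
isZero (suc _) = 0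

zeros : Vec (Fin n) k → ℕ
zeros xs = sum λ i → isZero (lookup xs i)

zeros≤ : (xs : Vec (Fin n) k) → zeros xs ≤ k
zeros≤ []           = z≤n
zeros≤ (zero  ∷ xs) = s≤s (zeros≤ xs)
zeros≤ (suc _ ∷ xs) = m≤n⇒m≤1+n (zeros≤ xs)

zeros-full : (xs : Vec (Fin (suc n)) k) → zeros xs ≡ k → xs ≡ replicate k zero
zeros-full []           _  = refl
zeros-full (zero  ∷ xs) eq = cong (zero ∷_) (zeros-full xs (suc-injective eq))
zeros-full (suc _ ∷ xs) eq = contradiction (≤-reflexive (sym eq)) (≤⇒≯ (zeros≤ xs))

zeros-∷ʳ : ∀ (xs : Vec (Fin n) k) x → zeros (xs ∷ʳ x) ≡ zeros (x ∷ xs)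
zeros-∷ʳ []       x = refl
zeros-∷ʳ (y ∷ xs) x = begin
  isZero y + zeros (xs ∷ʳ x)        ≡⟨ cong (isZero y +_) (zeros-∷ʳ xs x) ⟩
  isZero y + (isZero x + zeros xs)  ≡⟨ x∙yz≈y∙xz (isZero y) (isZero x) (zeros xs) ⟩
  isZero x + (isZero y + zeros xs)  ∎
  where open ≡-Reasoning

zeros-rotate : (xs : Vec (Fin n) (suc k)) → zeros (rotate xs) ≡ zeros xs
zeros-rotate (x ∷ xs) = zeros-∷ʳ xs x

lookup-∷ʳ-inject₁ : ∀ (xs : Vec (Fin n) k) x i → lookup (xs ∷ʳ x) (inject₁ i) ≡ lookup xs i
lookup-∷ʳ-inject₁ (y ∷ xs) x zero    = refl
lookup-∷ʳ-inject₁ (y ∷ xs) x (suc i) = lookup-∷ʳ-inject₁ xs x i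

-- Words avoiding `zero` are words over an alphabet with one letter fewer.
Σᵛ-zero-free : (F : Vec (Fin (suc n)) k → ℕ) →
               Σᵛ (λ xs → 𝟙 (zeros xs ℕ.≟ 0) * F xs) ≡ Σᵛ (F ∘ Vec.map suc)
Σᵛ-zero-free {k = zero}  F = +-identityʳ _
Σᵛ-zero-free {k = suc k} F =
  cong₂ _+_ (Σᵛ-zero {k = k} _ λ xs → refl)
            (sum-cong-≗ λ x → Σᵛ-zero-free λ xs → F (suc x ∷ xs))

Invariant : (Vec (Fin n) (suc k) → ℕ) → Set
Invariant F = ∀ xs → F (rotate xs) ≡ F xs

-- Double counting of the zeros by position: rotation carries each position to the previous one, so
-- all positions contribute equally.
Σᵛ-zeros : (F : Vec (Fin n) (suc k) → ℕ) → Invariant F →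
           Σᵛ (λ xs → zeros xs * F xs) ≡ suc k * Σᵛ (λ xs → isZero (lookup xs zero) * F xs)
Σᵛ-zeros {k = k} F inv = begin
  Σᵛ (λ xs → zeros xs * F xs)
    ≡⟨ Σᵛ-cong (λ xs → *-distribʳ-sum (F xs) (λ i → isZero (lookup xs i))) ⟩
  Σᵛ (λ xs → sum λ i → isZero (lookup xs i) * F xs)
    ≡⟨ Σᵛ-comm (λ i xs → isZero (lookup xs i) * F xs) ⟨
  sum (λ i → at i)
    ≡⟨ sum-cong-≗ (<-weakInduction (λ i → at i ≡ at zero) refl (λ i → trans (step i))) ⟩
  sum {suc k} (λ _ → at zero)
    ≡⟨ sum-const (suc k) (at zero) ⟩
  suc k * at zero ∎
  where
  open ≡-Reasoning
  at : Fin (suc k) → ℕ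
  at i = Σᵛ λ xs → isZero (lookup xs i) * F xs

  step : ∀ i → at (suc i) ≡ at (inject₁ i)
  step i = trans (Σᵛ-cong shift) (Σᵛ-rotate λ xs → isZero (lookup xs (inject₁ i)) * F xs)
    where
    shift : ∀ xs → isZero (lookup xs (suc i)) * F xs ≡
                   isZero (lookup (rotate xs) (inject₁ i)) * F (rotate xs)
    shift xs@(x ∷ ys) =
      cong₂ _*_ (cong isZero (sym (lookup-∷ʳ-inject₁ ys x i))) (sym (inv xs))

sum-𝟙-≟ : m < n → sum {n} (λ j → 𝟙 (m ℕ.≟ toℕ j)) ≡ 1
sum-𝟙-≟ {zero}  {suc n} _         = cong suc (sum-zero {n} _ λ _ → refl)
sum-𝟙-≟ {suc m} {suc n} (s≤s m<n) = sum-𝟙-≟ m<n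

-- Split the words by their number j of zeros.  Each position carries a zero
-- equally often, so j times the j-th part is a multiple of p; for 0 < j < p the
-- part itself is one, and j = 0 leaves a smaller alphabet.
prime∣Σᵛ : ∀ {k} → Prime (suc k) → ∀ n (F : Vec (Fin n) (suc k) → ℕ) → Invariant F →
           (∀ x → F (replicate (suc k) x) ≡ 0) → suc k ∣ Σᵛ F
prime∣Σᵛ         pr zero    F inv const = _ ∣0
prime∣Σᵛ {k = k} pr (suc n) F inv const =
  subst (p ∣_) (sym split) $ ∣m∣n⇒∣m+n zero-free (∣-sum _ positive)
  where
  open ≡-Reasoning
  p = suc k

  W : ℕ → Vec (Fin (suc n)) p → ℕ
  W j xs = 𝟙 (zeros xs ℕ.≟ j) * F xs

  split : Σᵛ F ≡ sum {suc p} λ j → Σᵛ (W (toℕ j))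
  split = begin
    Σᵛ F
      ≡⟨ Σᵛ-cong (λ xs → *-identityˡ (F xs)) ⟨
    Σᵛ (λ xs → 1 * F xs)
      ≡⟨ Σᵛ-cong (λ xs → cong (_* F xs) (sum-𝟙-≟ (s≤s (zeros≤ xs)))) ⟨
    Σᵛ (λ xs → sum {suc p} (λ j → 𝟙 (zeros xs ℕ.≟ toℕ j)) * F xs)
      ≡⟨ Σᵛ-cong (λ xs → *-distribʳ-sum {suc p} (F xs) (λ j → 𝟙 (zeros xs ℕ.≟ toℕ j))) ⟩
    Σᵛ (λ xs → sum {suc p} λ j → W (toℕ j) xs)
      ≡⟨ Σᵛ-comm {suc p} (λ j → W (toℕ j)) ⟨
    sum {suc p} (λ j → Σᵛ (W (toℕ j))) ∎

  zero-free : p ∣ Σᵛ (W 0)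
  zero-free = subst (p ∣_) (sym (Σᵛ-zero-free F)) $
    prime∣Σᵛ pr n (F ∘ Vec.map suc)
      (λ { (x ∷ xs) → trans (cong F (map-∷ʳ suc x xs)) (inv (suc x ∷ Vec.map suc xs)) })
      (λ x → trans (cong F (map-replicate suc x p)) (const (suc x)))

  weight : ∀ j xs → zeros xs * W j xs ≡ j * W j xs
  weight j xs = helper (zeros xs) (zeros xs ℕ.≟ j)
    where
    helper : ∀ m (m≟j : Dec (m ≡ j)) → m * (𝟙 m≟j * F xs) ≡ j * (𝟙 m≟j * F xs)
    helper m (yes refl) = refl
    helper m (no  _)    = trans (*-zeroʳ m) (sym (*-zeroʳ j))

  inv-W : ∀ j → Invariant (W j)
  inv-W j xs = cong₂ _*_ (cong (λ z → 𝟙 (z ℕ.≟ j)) (zeros-rotate xs)) (inv xs)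

  p∣j*W : ∀ j → p ∣ j * Σᵛ (W j)
  p∣j*W j = subst (p ∣_)
    (trans (sym (Σᵛ-zeros (W j) (inv-W j)))
      (trans (Σᵛ-cong (weight j)) (sym (Σᵛ-*ˡ j (W j)))))
    (m∣m*n _)

  -- The case j = p, where Euclid's lemma gives nothing: the only word with p zeros is constant, and
  -- `F` vanishes there.
  all-zero : ∀ xs → W p xs ≡ 0
  all-zero xs = helper (zeros xs ℕ.≟ p)
    where
    helper : (d : Dec (zeros xs ≡ p)) → 𝟙 d * F xs ≡ 0
    helper (yes eq) = trans (+-identityʳ (F xs)) (trans (cong F (zeros-full xs eq)) (const zero))
    helper (no  _)  = refl

  positive : ∀ (i : Fin p) → p ∣ Σᵛ (W (toℕ (Fin.suc i)))
  positive i with suc (toℕ i) ℕ.≟ p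
  ... | yes eq = subst (λ j → p ∣ Σᵛ (W j)) (sym eq)
                   (subst (p ∣_) (sym (Σᵛ-zero (W p) all-zero)) (p ∣0))
  ... | no neq with euclidsLemma (suc (toℕ i)) (Σᵛ (W (suc (toℕ i)))) pr (p∣j*W (suc (toℕ i)))
  ...   | inj₁ p∣j = contradiction p∣j (>⇒∤ (≤∧≢⇒< (toℕ<n i) neq))
  ...   | inj₂ p∣S = p∣S

-- Closed walks modulo p

_≡₁[mod_] : ℕ → ℕ → Set
m ≡₁[mod p ] = ∃ λ t → m ≡ 1 + p * t

-- Modulo p every factor `g i` is 1, so only the sum of the weights `f i` remains.
sum-≡₁ : ∀ p (f g : Fin n → ℕ) → (∀ i → g i ≡₁[mod p ]) → sum f ≡₁[mod p ] →
         (sum λ i → f i * g i) ≡₁[mod p ]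
sum-≡₁ p f g g≡1 (t , eq) = t + sum (λ i → f i * s i) , (begin
  sum (λ i → f i * g i)
    ≡⟨ sum-cong-≗ (λ i → trans (cong (f i *_) (proj₂ (g≡1 i))) (expand p (f i) (s i))) ⟩
  sum (λ i → f i + p * (f i * s i))
    ≡⟨ ∑-distrib-+ f _ ⟩
  sum f + sum (λ i → p * (f i * s i))
    ≡⟨ cong₂ _+_ eq (sym (*-distribˡ-sum p (λ i → f i * s i))) ⟩
  1 + p * t + p * sum (λ i → f i * s i)
    ≡⟨ cong suc (*-distribˡ-+ p t _) ⟨
  1 + p * (t + sum (λ i → f i * s i)) ∎)
  where
  open ≡-Reasoning
  s = λ i → proj₁ (g≡1 i)
  expand : ∀ p a b → a * (1 + p * b) ≡ a + p * (a * b)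
  expand = solve-∀

module _ (A : Fin n → Fin n → ℕ) where

  -- The word lists the inner vertices only, so summing over words of length k gives an entry of the
  -- matrix power A ^ (k + 1).
  walk : Fin n → Vec (Fin n) k → Fin n → ℕ
  walk x []       z = A x z
  walk x (y ∷ ys) z = A x y * walk y ys z

  closedWalk : Vec (Fin n) (suc k) → ℕ
  closedWalk (x ∷ xs) = walk x xs x

  walk-∷ʳ : ∀ x (ys : Vec (Fin n) k) y z → walk x (ys ∷ʳ y) z ≡ walk x ys y * A y z
  walk-∷ʳ x []       y z = refl
  walk-∷ʳ x (w ∷ ys) y z = trans (cong (A x w *_) (walk-∷ʳ w ys y z)) (sym (*-assoc (A x w) _ _))

  closedWalk-rotate : Invariant (closedWalk {suc k})
  closedWalk-rotate (x ∷ y ∷ ys) = trans (walk-∷ʳ y ys x y) (*-comm (walk y ys x) (A x y))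

  module _ {p} (rows : ∀ x → sum (A x) ≡₁[mod p ])
               (square : ∀ x z → (sum λ y → A x y * A y z) ≡₁[mod p ]) where

    walks : ∀ k → Fin n → Fin n → ℕ
    walks k x z = Σᵛ {k = k} λ ys → walk x ys z

    -- Modulo p the square of `A` is the all-ones matrix J, and A J = J by the row sums; hence every
    -- power from the second on is J.
    walks-≡₁ : ∀ k x z → walks (suc k) x z ≡₁[mod p ]
    walks-≡₁ zero    x z = square x z
    walks-≡₁ (suc k) x z = subst (_≡₁[mod p ]) step
      (sum-≡₁ p (A x) (λ y → walks (suc k) y z) (λ y → walks-≡₁ k y z) (rows x))
      where
      step : (sum λ y → A x y * walks (suc k) y z) ≡ walks (2+ k) x z
      step = sum-cong-≗ λ y → Σᵛ-*ˡ {k = suc k} (A x y) λ ys → walk y ys z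

    -- The sum is the trace of a power congruent to J, and J has trace n.
    closedWalks-≡₁ : ∀ k → n ≡₁[mod p ] → Σᵛ (closedWalk {suc k}) ≡₁[mod p ]
    closedWalks-≡₁ k n≡1 = subst (_≡₁[mod p ]) trace
      (sum-≡₁ p (λ _ → 1) (λ x → walks (suc k) x x) (λ x → walks-≡₁ k x x)
        (subst (_≡₁[mod p ]) (sym (trans (sum-const n 1) (*-identityʳ n))) n≡1))
      where
      trace : (sum λ x → 1 * walks (suc k) x x) ≡ Σᵛ (closedWalk {suc k})
      trace = sum-cong-≗ λ x → *-identityˡ (walks (suc k) x x)

-- The number of closed walks of length p is ≡ tr (A ^ p) ≡ n ≡ 1 (mod p), yet
-- without loops rotation shows it is a multiple of p.
¬loopless : ∀ {p} (A : Fin n → Fin n → ℕ) → Prime p → n ≡₁[mod p ] →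
            (∀ x → sum (A x) ≡₁[mod p ]) →
            (∀ x z → (sum λ y → A x y * A y z) ≡₁[mod p ]) →
            ¬ (∀ x → A x x ≡ 0)
¬loopless {p = zero}        _ pr = contradiction pr ¬prime[0]
¬loopless {p = suc zero}    _ pr = contradiction pr ¬prime[1]
¬loopless {n} {p = suc (suc k)} A pr n≡1 rows square loopless =
  contradiction (∣1⇒≡1 p∣1) λ ()
  where
  p∣closed : suc (suc k) ∣ Σᵛ (closedWalk A {suc k})
  p∣closed = prime∣Σᵛ pr n (closedWalk A {suc k}) (closedWalk-rotate A)
    -- A closed walk along a constant word starts with a loop.
    λ x → cong (_* walk A x (replicate k x) x) (loopless x)

  p∣1 : suc (suc k) ∣ 1
  p∣1 with closedWalks-≡₁ A {suc (suc k)} rows square k n≡1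
  ... | t , eq = ∣m+n∣m⇒∣n {suc (suc k)} {suc (suc k) * t}
    (subst (suc (suc k) ∣_) (trans eq (+-comm 1 (suc (suc k) * t))) p∣closed)
    (m∣m*n {suc (suc k)} t)

prime-divisor : ∀ q → 1 < q → ∃ λ p → Prime p × p ∣ q
prime-divisor q@(suc _) 1<q with factorise q
... | record { factors = []     ; isFactorisation = eq } = contradiction eq (>⇒≢ 1<q)
... | record { factors = p ∷ ps ; isFactorisation = eq ; factorsPrime = pr ∷ _ } =
  p , pr , subst (p ∣_) (sym eq) (m∣m*n _)

-- Independent sets of size n / Δ

module Independence
  {E : Rel (Fin n) 0ℓ} (E? : Decidable E) (E-sym : Symmetric E) (E-irrefl : ∀ {x} → ¬ E x x)
  {Δ : ℕ} (degree≤ : ∀ x → ∣ subsetOf (E? x) ∣ ≤ Δ)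
  (triangle : ∀ {x y} → E x y → ∃ λ z → E x z × E y z)
  where

  private variable
    x y w : Fin n
    S : Subset n

  nbr : Fin n → Subset n
  nbr x = subsetOf (E? x)

  ∈-nbr⁺ : E x y → y ∈ nbr x
  ∈-nbr⁺ {x = x} = ∈-subsetOf⁺ (E? x)

  ∈-nbr⁻ : y ∈ nbr x → E x y
  ∈-nbr⁻ {x = x} = ∈-subsetOf⁻ (E? x)

  deg : Subset n → Fin n → ℕ
  deg S x = ∣ nbr x ∩ S ∣

  deg≤ : ∀ S x → deg S x ≤ Δ
  deg≤ S x = ≤-trans (∣p∩q∣≤∣p∣ (nbr x) S) (degree≤ x)

  outside+deg≤ : ∀ S x → ∣ nbr x ─ S ∣ + deg S x ≤ Δ
  outside+deg≤ S x =
    subst (_≤ Δ) (trans (card-split (nbr x) S) (+-comm (deg S x) _)) (degree≤ x)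

  outside₁ : E x y → y ∉ S → suc (deg S x) ≤ Δ
  outside₁ {x} {S = S} xy y∉S = ≤-trans
    (+-monoˡ-≤ (deg S x) (x∈p⇒0<∣p∣ (x∈p∧x∉q⇒x∈p─q (∈-nbr⁺ xy) y∉S)))
    (outside+deg≤ S x)

  outside₂ : ∀ {z} → E x y → y ∉ S → E x z → z ∉ S → y ≢ z → 2 + deg S x ≤ Δ
  outside₂ {x} {S = S} xy y∉S xz z∉S y≢z = ≤-trans
    (+-monoˡ-≤ (deg S x) (x,y∈p⇒1<∣p∣
      (x∈p∧x∉q⇒x∈p─q (∈-nbr⁺ xy) y∉S) (x∈p∧x∉q⇒x∈p─q (∈-nbr⁺ xz) z∉S) y≢z))
    (outside+deg≤ S x)

  infixl 5 _⊖_
  -- One greedy step: choosing `x` rules out its closed neighbourhood.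
  _⊖_ : Subset n → Fin n → Subset n
  S ⊖ x = S - x ─ nbr x

  ∈-⊖⁺ : y ∈ S → y ≢ x → ¬ E x y → y ∈ S ⊖ x
  ∈-⊖⁺ y∈S y≢x ¬xy = x∈p∧x∉q⇒x∈p─q (x∈p∧x≢y⇒x∈p-y y∈S y≢x) (¬xy ∘ ∈-nbr⁻)

  ∈-⊖⁻ : y ∈ S ⊖ x → y ∈ S × y ≢ x × ¬ E x y
  ∈-⊖⁻ {S = S} {x = x} y∈ with x∈p─q⁻ (S - x) (nbr x) y∈
  ... | y∈S-x , y∉nbr with x∈p─q⁻ S ⁅ x ⁆ y∈S-x
  ...   | y∈S , y∉x = y∈S , (λ { refl → y∉x (x∈⁅x⁆ x) }) , y∉nbr ∘ ∈-nbr⁺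

  card-⊖ : x ∈ S → ∣ S ∣ ≡ suc (deg S x) + ∣ S ⊖ x ∣
  card-⊖ {x} {S} x∈S = begin
    ∣ S ∣
      ≡⟨ card-split S ⁅ x ⁆ ⟩
    ∣ S ∩ ⁅ x ⁆ ∣ + ∣ S - x ∣
      ≡⟨ cong (λ q → ∣ q ∣ + ∣ S - x ∣) (⊆-antisym (p∩q⊆q S ⁅ x ⁆)
           λ y∈ → x∈p∩q⁺ (subst (_∈ S) (sym (x∈⁅y⁆⇒x≡y x y∈)) x∈S , y∈)) ⟩
    ∣ ⁅ x ⁆ ∣ + ∣ S - x ∣
      ≡⟨ cong₂ _+_ (∣⁅x⁆∣≡1 x) (card-split (S - x) (nbr x)) ⟩
    suc (∣ (S - x) ∩ nbr x ∣ + ∣ S ⊖ x ∣)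
      ≡⟨ cong (λ q → suc (∣ q ∣ + ∣ S ⊖ x ∣)) (⊆-antisym there⊆ back⊆) ⟩
    suc (deg S x + ∣ S ⊖ x ∣) ∎
    where
    open ≡-Reasoning
    there⊆ : (S - x) ∩ nbr x ⊆ nbr x ∩ S
    there⊆ y∈ with x∈p∩q⁻ (S - x) (nbr x) y∈
    ... | y∈S-x , y∈nbr = x∈p∩q⁺ (y∈nbr , p─q⊆p S ⁅ x ⁆ y∈S-x)
    back⊆ : nbr x ∩ S ⊆ (S - x) ∩ nbr x
    back⊆ y∈ with x∈p∩q⁻ (nbr x) S y∈
    ... | y∈nbr , y∈S = x∈p∩q⁺ (x∈p∧x≢y⇒x∈p-y y∈S (λ { refl → E-irrefl (∈-nbr⁻ y∈nbr) }) , y∈nbr)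

  ⊖-< : x ∈ S → ∣ S ⊖ x ∣ < ∣ S ∣
  ⊖-< {x} {S} x∈S = subst (∣ S ⊖ x ∣ <_) (sym (card-⊖ x∈S)) (s≤s (m≤n+m _ (deg S x)))

  Independent : Subset n → Set
  Independent I = ∀ {x y} → x ∈ I → y ∈ I → ¬ E x y

  -- The bound (e + |S|) / Δ on the size of `I`, cleared of division. The surplus `e` pays for a
  -- ball of Δ + 1 vertices elsewhere.
  Large : ℕ → Subset n → Set
  Large e S = ∃ λ I → I ⊆ S × Independent I × e + ∣ S ∣ ≤ Δ * ∣ I ∣

  Clique : Subset n → Set
  Clique K = ∀ {x y} → x ∈ K → y ∈ K → x ≢ y → E x y

  BigClique : Set
  BigClique = ∃ λ K → Clique K × suc Δ ≤ ∣ K ∣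

  -- One more element of `I` is worth Δ, while the ball of `x` costs `suc (deg S x)` vertices; the
  -- inequality balances this against the change of surplus.
  extend : ∀ e f → x ∈ S → f + suc (deg S x) ≤ e + Δ → Large e (S ⊖ x) → Large f S
  extend {x} {S} e f x∈S gain (I , I⊆ , ind , large) =
    ⁅ x ⁆ ∪ I , sub , ind′ , bound
    where
    ⁅x⁆∪⁻ : y ∈ ⁅ x ⁆ ∪ I → y ≡ x ⊎ y ∈ I
    ⁅x⁆∪⁻ = map₁ (x∈⁅y⁆⇒x≡y x) ∘ x∈p∪q⁻ ⁅ x ⁆ I

    sub : ⁅ x ⁆ ∪ I ⊆ S
    sub y∈ with ⁅x⁆∪⁻ y∈
    ... | inj₁ refl = x∈S
    ... | inj₂ y∈I  = proj₁ (∈-⊖⁻ {S = S} (I⊆ y∈I))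

    ind′ : Independent (⁅ x ⁆ ∪ I)
    ind′ y∈ z∈ yz with ⁅x⁆∪⁻ y∈ | ⁅x⁆∪⁻ z∈
    ... | inj₁ refl | inj₁ refl = E-irrefl yz
    ... | inj₁ refl | inj₂ z∈I  = proj₂ (proj₂ (∈-⊖⁻ {S = S} (I⊆ z∈I))) yz
    ... | inj₂ y∈I  | inj₁ refl = proj₂ (proj₂ (∈-⊖⁻ {S = S} (I⊆ y∈I))) (E-sym yz)
    ... | inj₂ y∈I  | inj₂ z∈I  = ind y∈I z∈I yz

    open ≤-Reasoning
    bound : f + ∣ S ∣ ≤ Δ * ∣ ⁅ x ⁆ ∪ I ∣
    bound = begin
      f + ∣ S ∣                        ≡⟨ cong (f +_) (card-⊖ x∈S) ⟩
      f + (suc (deg S x) + ∣ S ⊖ x ∣)  ≡⟨ +-assoc f _ _ ⟨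
      f + suc (deg S x) + ∣ S ⊖ x ∣    ≤⟨ +-monoˡ-≤ ∣ S ⊖ x ∣ gain ⟩
      e + Δ + ∣ S ⊖ x ∣                ≡⟨ cong (_+ ∣ S ⊖ x ∣) (+-comm e Δ) ⟩
      Δ + e + ∣ S ⊖ x ∣                ≡⟨ +-assoc Δ e _ ⟩
      Δ + (e + ∣ S ⊖ x ∣)              ≤⟨ +-monoʳ-≤ Δ large ⟩
      Δ + Δ * ∣ I ∣                    ≡⟨ *-suc Δ ∣ I ∣ ⟨
      Δ * suc ∣ I ∣                    ≡⟨ cong (Δ *_) (∣⁅x⁆∪p∣ x∉I) ⟨
      Δ * ∣ ⁅ x ⁆ ∪ I ∣                ∎
      where
      x∉I : x ∉ I
      x∉I x∈I = proj₁ (proj₂ (∈-⊖⁻ {S = S} (I⊆ x∈I))) refl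

  Boundary : Subset n → Set
  Boundary S = ∃ λ x → ∃ λ y → x ∈ S × y ∉ S × E x y

  boundary? : U.Decidable Boundary
  boundary? S = any? λ x → any? λ y → x ∈? S ×-dec ¬? (y ∈? S) ×-dec E? x y

  ball : Subset n → Fin n → Subset n
  ball S x = ⁅ x ⁆ ∪ (nbr x ∩ S)

  ball⁻ : ∀ S {x y} → y ∈ ball S x → y ≡ x ⊎ E x y × y ∈ S
  ball⁻ S {x} y∈ with x∈p∪q⁻ ⁅ x ⁆ (nbr x ∩ S) y∈
  ... | inj₁ y∈x = inj₁ (x∈⁅y⁆⇒x≡y x y∈x)
  ... | inj₂ y∈∩ = inj₂ (map ∈-nbr⁻ id (x∈p∩q⁻ (nbr x) S y∈∩))

  centre∈ball : ∀ S x → x ∈ ball S x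
  centre∈ball S x = p⊆p∪q (nbr x ∩ S) (x∈⁅x⁆ x)

  nbr∈ball : E x y → y ∈ S → y ∈ ball S x
  nbr∈ball {x} {S = S} xy y∈S = q⊆p∪q ⁅ x ⁆ (nbr x ∩ S) (x∈p∩q⁺ (∈-nbr⁺ xy , y∈S))

  ∣ball∣ : ∀ S x → ∣ ball S x ∣ ≡ suc (deg S x)
  ∣ball∣ S x = ∣⁅x⁆∪p∣ (E-irrefl ∘ ∈-nbr⁻ ∘ proj₁ ∘ x∈p∩q⁻ (nbr x) S)

  -- Otherwise the neighbours of `x` in `S` would avoid both `x` and `y`, and there would be too few
  -- of them.
  full-degree : x ∈ S → ∣ S ∣ ≤ suc (deg S x) → y ∈ S → x ≢ y → E x y
  full-degree {x} {S} {y} x∈S full y∈S x≢y = decidable-stable (E? x y) λ ¬xy →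
    <⇒≱ (≤-<-trans (≤-<-trans (p⊆q⇒∣p∣≤∣q∣ (smaller ¬xy))
                       (x∈p⇒∣p-x∣<∣p∣ (x∈p∧x≢y⇒x∈p-y y∈S (x≢y ∘ sym))))
                    (x∈p⇒∣p-x∣<∣p∣ x∈S))
        full
    where
    smaller : ¬ E x y → nbr x ∩ S ⊆ S - x - y
    smaller ¬xy {z} z∈ with x∈p∩q⁻ (nbr x) S z∈
    ... | z∈nbr , z∈S = x∈p∧x≢y⇒x∈p-y
      (x∈p∧x≢y⇒x∈p-y z∈S λ { refl → E-irrefl (∈-nbr⁻ z∈nbr) }) λ { refl → ¬xy (∈-nbr⁻ z∈nbr) }

  -- No edge leaves the rest of `S`, so a vertex of the ball has all its neighbours in `S` within
  -- the ball. By minimality of `deg S w` there are enough of them to fill it.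
  ball-clique : w ∈ S → ¬ Boundary (S ⊖ w) → (∀ {x} → x ∈ S → deg S w ≤ deg S x) →
                Clique (ball S w)
  ball-clique {w} {S} w∈S closed min {x} x∈K = full-degree x∈K (begin
    ∣ ball S w ∣             ≡⟨ ∣ball∣ S w ⟩
    suc (deg S w)            ≤⟨ s≤s (min (ball⊆ x∈K)) ⟩
    suc (deg S x)            ≤⟨ s≤s (p⊆q⇒∣p∣≤∣q∣ inside-ball) ⟩
    suc (deg (ball S w) x)   ∎)
    where
    open ≤-Reasoning
    ball⊆ : ball S w ⊆ S
    ball⊆ y∈ with ball⁻ S y∈
    ... | inj₁ refl      = w∈S
    ... | inj₂ (_ , y∈S) = y∈S

    x∉⊖ : x ∉ S ⊖ w
    x∉⊖ x∈ with ∈-⊖⁻ {S = S} x∈ | ball⁻ S x∈K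
    ... | _ , x≢w , _   | inj₁ x≡w      = x≢w x≡w
    ... | _ , _   , ¬wx | inj₂ (wx , _) = ¬wx wx

    inside-ball : nbr x ∩ S ⊆ nbr x ∩ ball S w
    inside-ball {y} y∈ with x∈p∩q⁻ (nbr x) S y∈
    ... | y∈nbr , y∈S = x∈p∩q⁺ (y∈nbr , decidable-stable (y ∈? ball S w) λ y∉ → closed
      (y , x , ∈-⊖⁺ y∈S (λ { refl → y∉ (centre∈ball S w) }) (λ wy → y∉ (nbr∈ball wy y∈S))
       , x∉⊖ , E-sym (∈-nbr⁻ y∈nbr)))

  -- A good start for the greedy procedure: after the ball of `a`, the vertex `b` remains but has
  -- lost both `c` and `d`.
  record Diamond (S : Subset n) (a b c d : Fin n) : Set where
    constructor diamond
    field
      a∈ : a ∈ S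
      b∈ : b ∈ S
      a≢b : a ≢ b
      c≢d : c ≢ d
      ¬ab : ¬ E a b
      ac : E a c
      bc : E b c
      ad : E a d
      bd : E b d

  diamond? : ∀ S a b c d → Dec (Diamond S a b c d)
  diamond? S a b c d = map′
    (λ { (p , q , r , s , t , u , v , w , z) → diamond p q r s t u v w z })
    (λ { (diamond p q r s t u v w z) → (p , q , r , s , t , u , v , w , z) })
    (a ∈? S ×-dec b ∈? S ×-dec ¬? (a ≟ b) ×-dec ¬? (c ≟ d) ×-dec ¬? (E? a b)
     ×-dec E? a c ×-dec E? b c ×-dec E? a d ×-dec E? b d)


  -- Greedily removing closed balls costs at most Δ vertices per ball as soon as
  -- its centre has lost a neighbour.  Only the first ball of a component may cost
  -- Δ + 1, and a centre that has lost two neighbours makes up for it.  If that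
  -- never happens then the last ball is a Δ-clique with one neighbour outside,
  -- which is joined to all of it: otherwise two non-adjacent vertices with
  -- two common neighbours would have been a better start.
  module Step (R : Subset n)
    (smaller : ∀ R′ → ∣ R′ ∣ < ∣ R ∣ → Large 0 R′ ⊎ BigClique) where

    module Regular (degree≥ : ∀ {x} → x ∈ R → Δ ≤ deg R x)
      (no-diamond : ∀ {a b c d} → ¬ Diamond R a b c d) where

      absorbed : x ∈ R → E x y → y ∈ R
      absorbed {y = y} x∈R xy = decidable-stable (y ∈? R) λ y∉R →
        <⇒≱ (outside₁ xy y∉R) (degree≥ x∈R)

      last-ball : S ⊆ R → (∀ {x} → x ∈ S → Δ ≤ suc (deg S x)) → ∀ {w z} → w ∈ S → z ∉ S → E w z →
                  ¬ Boundary (S ⊖ w) → BigClique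
      last-ball {S} S⊆R tight {w} {z} w∈S z∉S wz closed =
        ⁅ z ⁆ ∪ K , clique , subst (suc Δ ≤_) (sym size) (s≤s (tight w∈S))
        where
        K = ball S w

        K⊆S : K ⊆ S
        K⊆S k∈ with ball⁻ S k∈
        ... | inj₁ refl      = w∈S
        ... | inj₂ (_ , k∈S) = k∈S

        clique-K : Clique K
        -- The loss of `z` leaves `w` with degree at most Δ - 1, which is the least degree that
        -- `tight` permits.
        clique-K = ball-clique w∈S closed λ x∈S →
          s≤s⁻¹ (≤-trans (outside₁ wz z∉S) (tight x∈S))

        size : ∣ ⁅ z ⁆ ∪ K ∣ ≡ 2 + deg S w
        size = trans (∣⁅x⁆∪p∣ (z∉S ∘ K⊆S)) (cong suc (∣ball∣ S w))

        -- By `tight`, `w` has lost no neighbour but `z`, so the third vertex of a triangle on this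
        -- edge lies in the ball.
        u = proj₁ (triangle wz)
        wu : E w u
        wu = proj₁ (proj₂ (triangle wz))
        zu : E z u
        zu = proj₂ (proj₂ (triangle wz))

        u∈K : u ∈ K
        u∈K = nbr∈ball wu (decidable-stable (u ∈? S) λ u∉S →
          <⇒≱ (outside₂ wz z∉S wu u∉S λ z≡u → E-irrefl (subst (E z) (sym z≡u) zu)) (tight w∈S))

        -- Both `w` and `u` are adjacent to `z` and `k`, so a missing edge between these two would
        -- complete a diamond.
        zk : ∀ {k} → k ∈ K → E z k
        zk {k} k∈K with k ≟ w | k ≟ u | E? z k
        ... | yes refl | _        | _       = E-sym wz
        ... | no _     | yes refl | _       = zu
        ... | no _     | no _     | yes zk′ = zk′
        ... | no k≢w   | no k≢u   | no ¬zk  = contradiction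
          (diamond (absorbed (S⊆R w∈S) wz) (S⊆R (K⊆S k∈K)) (λ { refl → z∉S (K⊆S k∈K) })
             (λ w≡u → E-irrefl (subst (E w) (sym w≡u) wu)) ¬zk
             (E-sym wz) (clique-K k∈K (centre∈ball S w) k≢w) zu (clique-K k∈K u∈K k≢u))
          no-diamond

        clique : Clique (⁅ z ⁆ ∪ K)
        clique p∈ q∈ p≢q with x∈p∪q⁻ ⁅ z ⁆ K p∈ | x∈p∪q⁻ ⁅ z ⁆ K q∈
        ... | inj₁ p∈z | inj₁ q∈z =
          contradiction (trans (x∈⁅y⁆⇒x≡y z p∈z) (sym (x∈⁅y⁆⇒x≡y z q∈z))) p≢q
        ... | inj₁ p∈z | inj₂ q∈K = subst (λ v → E v _) (sym (x∈⁅y⁆⇒x≡y z p∈z)) (zk q∈K)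
        ... | inj₂ p∈K | inj₁ q∈z = subst (E _) (sym (x∈⁅y⁆⇒x≡y z q∈z)) (E-sym (zk p∈K))
        ... | inj₂ p∈K | inj₂ q∈K = clique-K p∈K q∈K p≢q

      gain : ∀ S → Acc _<_ ∣ S ∣ → S ⊆ R → ∣ S ∣ < ∣ R ∣ → Boundary S → Large 1 S ⊎ BigClique
      gain S (acc rec) S⊆R S<R (w , z , w∈S , z∉S , wz)
        with any? (λ x → x ∈? S ×-dec 2 + deg S x ≤? Δ)
      -- A ball of at most Δ - 1 vertices yields the surplus at once; the rest follows by induction
      -- on `R`.
      ... | yes (x , x∈S , low) =
        map₁ (extend 0 1 x∈S low) (smaller (S ⊖ x) (<-trans (⊖-< x∈S) S<R))
      ... | no none with boundary? (S ⊖ w)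
      -- The centre `w` has lost `z`, so its ball costs at most Δ and the surplus is left to a later
      -- ball.
      ...   | yes bd = map₁ (extend 1 1 w∈S (s≤s (outside₁ wz z∉S)))
        (gain (S ⊖ w) (rec (⊖-< w∈S)) (S⊆R ∘ proj₁ ∘ ∈-⊖⁻) (<-trans (⊖-< w∈S) S<R) bd)
      ...   | no closed = inj₂ $ last-ball S⊆R
        (λ {x} x∈S → s≤s⁻¹ (≰⇒> λ low → none (x , x∈S , low))) w∈S z∉S wz closed

      regular : Large 0 R ⊎ BigClique
      regular with nonempty? R
      ... | no empty = inj₁ (⊥ , (λ x∈ → contradiction x∈ ∉⊥) , (λ x∈ → contradiction x∈ ∉⊥)
        , subst (_≤ Δ * ∣ ⊥ {n} ∣) (trans (sym (∣⊥∣≡0 n)) (cong ∣_∣ (sym (Empty-unique empty)))) z≤n)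
      ... | yes (x , x∈R) with boundary? (R ⊖ x)
      ...   | yes bd = map₁ (extend 1 0 x∈R (s≤s (deg≤ R x)))
        (gain (R ⊖ x) (<-wellFounded _) (proj₁ ∘ ∈-⊖⁻) (⊖-< x∈R) bd)
      -- With nothing left to continue from, the first ball is closed off, and full degrees make it
      -- a clique on Δ + 1 vertices.
      ...   | no closed = inj₂ (ball R x
        , ball-clique x∈R closed (λ y∈R → ≤-trans (deg≤ R x) (degree≥ y∈R))
        , subst (suc Δ ≤_) (sym (∣ball∣ R x)) (s≤s (degree≥ x∈R)))

    step : Large 0 R ⊎ BigClique
    step with any? (λ x → x ∈? R ×-dec suc (deg R x) ≤? Δ)
    ... | yes (x , x∈R , low) = map₁ (extend 0 0 x∈R low) (smaller (R ⊖ x) (⊖-< x∈R))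
    ... | no saturated with any? (λ a → any? λ b → any? λ c → any? λ d → diamond? R a b c d)
    ...   | yes (a , b , c , d , diamond a∈ b∈ a≢b c≢d ¬ab ac bc ad bd) =
      map₁ (extend 1 0 a∈ (s≤s (deg≤ R a)) ∘ extend 0 1 b∈′ low)
        (smaller (R ⊖ a ⊖ b) (<-trans (⊖-< b∈′) (⊖-< a∈)))
      where
      b∈′ : b ∈ R ⊖ a
      b∈′ = ∈-⊖⁺ b∈ (a≢b ∘ sym) ¬ab
      removed : ∀ {v} → E a v → v ∉ R ⊖ a
      removed av v∈ = proj₂ (proj₂ (∈-⊖⁻ {S = R} v∈)) av
      low : 2 + deg (R ⊖ a) b ≤ Δ
      low = outside₂ bc (removed ac) bd (removed ad) c≢d
    ...   | no no-diamond = Regular.regular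
      (λ {x} x∈R → s≤s⁻¹ (≰⇒> λ low → saturated (x , x∈R , low)))
      (λ D → no-diamond (_ , _ , _ , _ , D))

  independence : ∀ R → Acc _<_ ∣ R ∣ → Large 0 R ⊎ BigClique
  independence R (acc rec) = Step.step R λ R′ R′<R → independence R′ (rec R′<R)

-- Common neighbours in a regular graph

module RegularGraph {q : ℕ} (G : Graph n) (regular : Regular (suc q) G) where

  open Graph G public using (Adj; adj?; N; irrefl) renaming (sym to Adj-sym)

  private variable
    u v w x y : Fin n

  r Δ : ℕ
  r = suc q
  Δ = r * q

  A : Fin n → Fin n → ℕ
  A u v = 𝟙 (adj? u v)

  A≡1 : Adj u v → A u v ≡ 1
  A≡1 = 𝟙-yes (adj? _ _)

  A≡0 : ¬ Adj u v → A u v ≡ 0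
  A≡0 = 𝟙-no (adj? _ _)

  A-sym : ∀ u v → A u v ≡ A v u
  A-sym u v with adj? u v
  ... | yes uv = sym (A≡1 (Adj-sym uv))
  ... | no ¬uv = sym (A≡0 (¬uv ∘ Adj-sym))

  A-idem : ∀ u v → A u v * A u v ≡ A u v
  A-idem u v with adj? u v
  ... | yes _ = refl
  ... | no  _ = refl

  col : ∀ v → (sum λ u → A u v) ≡ r
  col v = trans (sym (card-subsetOf λ u → adj? u v)) (regular v)

  row : ∀ u → sum (A u) ≡ r
  row u = trans (sum-cong-≗ (A-sym u)) (col u)

  -- An entry of the squared adjacency matrix, that is, the number of common neighbours.
  codeg : Fin n → Fin n → ℕ
  codeg v w = sum λ u → A v u * A u w

  common⁺ : Adj x u → Adj u y → A x u * A u y ≡ 1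
  common⁺ xu uy = cong₂ _*_ (A≡1 xu) (A≡1 uy)

  common⁻ : 0 < A x u * A u y → Adj x u × Adj u y
  common⁻ {x} {u} {y} 0<c with adj? x u | adj? u y | 0<c
  ... | yes xu | yes uy | _  = xu , uy
  ... | yes _  | no  _  | ()
  ... | no  _  | _      | ()

  codeg≥1 : Adj x u → Adj u y → 1 ≤ codeg x y
  codeg≥1 {x} {u} {y} xu uy =
    subst (_≤ codeg x y) (common⁺ xu uy) (term≤sum (λ u → A x u * A u y) u)

  codeg≥2 : Adj x u → Adj u y → Adj x v → Adj v y → u ≢ v → 2 ≤ codeg x y
  codeg≥2 {x} {u} {y} {v} xu uy xv vy u≢v =
    subst (_≤ codeg x y) (cong₂ _+_ (common⁺ xu uy) (common⁺ xv vy))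
      (terms≤sum (λ u → A x u * A u y) u≢v)

  codeg-self : ∀ v → codeg v v ≡ r
  codeg-self v = trans (sum-cong-≗ λ u → trans (cong (A v u *_) (A-sym u v)) (A-idem v u)) (row v)

  -- Walks of length two from `v`, counted by their middle vertex.
  sum-codeg : ∀ v → sum (codeg v) ≡ r * r
  sum-codeg v = begin
    (sum λ w → sum λ u → A v u * A u w)
      ≡⟨ ∑-comm (λ w u → A v u * A u w) ⟩
    (sum λ u → sum λ w → A v u * A u w)
      ≡⟨ sum-cong-≗ (λ u → trans (sym (*-distribˡ-sum (A v u) (A u))) (cong (A v u *_) (row u))) ⟩
    (sum λ u → A v u * r)
      ≡⟨ *-distribʳ-sum r (A v) ⟨
    sum (A v) * r
      ≡⟨ cong (_* r) (row v) ⟩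
    r * r ∎
    where open ≡-Reasoning

  -- Adjacency in the graph H.
  Meets : Fin n → Fin n → Set
  Meets x y = x ≢ y × ∃ λ u → Adj x u × Adj u y

  meets? : ∀ x y → Dec (Meets x y)
  meets? x y = ¬? (x ≟ y) ×-dec any? λ u → adj? x u ×-dec adj? u y

  meets-sym : Meets x y → Meets y x
  meets-sym (x≢y , u , xu , uy) = x≢y ∘ sym , u , Adj-sym uy , Adj-sym xu

  sum-with-self : ∀ v c (f : Fin n → ℕ) → (sum λ w → f w + 𝟙 (v ≟ w) * c) ≡ sum f + c
  sum-with-self v c f =
    trans (∑-distrib-+ f (λ w → 𝟙 (v ≟ w) * c)) (cong (sum f +_) (sum-at v λ _ → c))

  r*r≡ : r * r ≡ suc Δ + q
  r*r≡ = trans (*-suc r q) (cong suc (+-comm q Δ))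

  -- Of the r * r walks of length two from `v`, r return to `v`, and each vertex meeting `v` ends at
  -- least one of the others.
  meets-degree : ∀ v → ∣ subsetOf (meets? v) ∣ ≤ Δ
  meets-degree v = +-cancelʳ-≤ r _ _ (begin
    ∣ subsetOf (meets? v) ∣ + r
      ≡⟨ cong (_+ r) (card-subsetOf (meets? v)) ⟩
    sum (λ w → 𝟙 (meets? v w)) + r
      ≡⟨ sum-with-self v r (λ w → 𝟙 (meets? v w)) ⟨
    (sum λ w → 𝟙 (meets? v w) + 𝟙 (v ≟ w) * r)
      ≤⟨ sum-mono-≤ bound ⟩
    sum (codeg v)
      ≡⟨ trans (sum-codeg v) (trans r*r≡ (sym (+-suc Δ q))) ⟩
    Δ + r ∎)
    where
    open ≤-Reasoning
    bound : ∀ w → 𝟙 (meets? v w) + 𝟙 (v ≟ w) * r ≤ codeg v w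
    bound w = helper (v ≟ w) (meets? v w)
      where
      helper : (v≟w : Dec (v ≡ w)) (m : Dec (Meets v w)) → 𝟙 m + 𝟙 v≟w * r ≤ codeg v w
      helper (yes refl) (yes (v≢v , _)) = contradiction refl v≢v
      helper (yes refl) (no _) = ≤-reflexive (trans (+-identityʳ r) (sym (codeg-self v)))
      helper (no _) (yes (_ , u , vu , uw)) = codeg≥1 vu uw
      helper (no _) (no _) = z≤n

  -- The common neighbour `u` has degree at least 3, and all its neighbours meet one another through
  -- `u`.
  meets-triangle : 2 ≤ q → Meets x y → ∃ λ z → Meets x z × Meets y z
  meets-triangle {x} {y} 2≤q (x≢y , u , xu , uy)
    with third-element {p = N u} (subst (2 <_) (sym (regular u)) (s≤s 2≤q)) x y
  ... | z , z∈N , z≢x , z≢y = z , (z≢x ∘ sym , u , xu , uz) , (z≢y ∘ sym , u , Adj-sym uy , uz)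
    where uz = Adj-sym (∈-subsetOf⁻ (λ w → adj? w u) z∈N)

  -- Two elements of K have exactly one common neighbour, and an element of K has
  -- none with a vertex outside K; the last term corrects codeg v v = r.
  Design : Subset n → Set
  Design K = ∣ K ∣ ≡ suc Δ × (∀ {v} → v ∈ K → ∀ w → codeg v w ≡ 𝟙 (w ∈? K) + 𝟙 (v ≟ w) * q)

  sum-design : ∀ K v → (sum λ w → 𝟙 (w ∈? K) + 𝟙 (v ≟ w) * q) ≡ ∣ K ∣ + q
  sum-design K v =
    trans (sum-with-self v q λ w → 𝟙 (w ∈? K)) (cong (_+ q) (sym (card-sum K)))

  -- Of the walks of length two from a vertex of `K`, r return and at least one ends at each other
  -- vertex of `K`. These already exhaust all r * r, so every bound is attained.
  clique⇒design : ∀ K → (∀ {x y} → x ∈ K → y ∈ K → x ≢ y → Meets x y) → suc Δ ≤ ∣ K ∣ → Design K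
  clique⇒design K clique large = size , λ {v} v∈K w → sym (sum-squeeze (bound v∈K) (total v) w)
    where
    bound : ∀ {v} → v ∈ K → ∀ w → 𝟙 (w ∈? K) + 𝟙 (v ≟ w) * q ≤ codeg v w
    bound {v} v∈K w = helper (v ≟ w) (w ∈? K)
      where
      helper : (v≟w : Dec (v ≡ w)) (m : Dec (w ∈ K)) → 𝟙 m + 𝟙 v≟w * q ≤ codeg v w
      helper (yes refl) (no v∉K)  = contradiction v∈K v∉K
      helper (yes refl) (yes _)   =
        ≤-reflexive (trans (cong suc (+-identityʳ q)) (sym (codeg-self v)))
      helper (no v≢w)   (yes w∈K) with clique v∈K w∈K v≢w
      ... | _ , u , vu , uw = codeg≥1 vu uw
      helper (no _)     (no _)    = z≤n

    total : ∀ v → sum (codeg v) ≤ sum λ w → 𝟙 (w ∈? K) + 𝟙 (v ≟ w) * q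
    total v = begin
      sum (codeg v)  ≡⟨ trans (sum-codeg v) r*r≡ ⟩
      suc Δ + q      ≤⟨ +-monoˡ-≤ q large ⟩
      ∣ K ∣ + q      ≡⟨ sum-design K v ⟨
      (sum λ w → 𝟙 (w ∈? K) + 𝟙 (v ≟ w) * q) ∎
      where open ≤-Reasoning

    size : ∣ K ∣ ≡ suc Δ
    size with 0<∣p∣⇒nonempty {p = K} (≤-trans z<s large)
    ... | v , v∈K = +-cancelʳ-≡ q _ _ (begin
      ∣ K ∣ + q      ≡⟨ sum-design K v ⟨
      (sum λ w → 𝟙 (w ∈? K) + 𝟙 (v ≟ w) * q)
                     ≡⟨ sum-cong-≗ (sum-squeeze (bound v∈K) (total v)) ⟩
      sum (codeg v)  ≡⟨ trans (sum-codeg v) r*r≡ ⟩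
      suc Δ + q      ∎)
      where open ≡-Reasoning

  neighbour? : ∀ K u → Dec (∃ λ x → x ∈ K × Adj x u)
  neighbour? K u = any? λ x → x ∈? K ×-dec adj? x u

  neighbours : Subset n → Subset n
  neighbours K = subsetOf (neighbour? K)

  module DesignProperties {K : Subset n} (design : Design K) where

    L : Subset n
    L = neighbours K

    K⇒L : x ∈ K → Adj x u → u ∈ L
    K⇒L x∈K xu = ∈-subsetOf⁺ (neighbour? K) (_ , x∈K , xu)

    -- A vertex outside `K` has codegree 0 with each vertex of `K`, so no walk of length two leaves
    -- `K`.
    L⇒K : u ∈ L → Adj u y → y ∈ K
    L⇒K {u} {y} u∈L uy with ∈-subsetOf⁻ (neighbour? K) u∈L
    ... | x , x∈K , xu with x ≟ y
    ...   | yes refl = x∈K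
    ...   | no  x≢y  = decidable-stable (y ∈? K) λ y∉K →
      <⇒≢ (codeg≥1 xu uy) (sym (trans (proj₂ design x∈K y)
        (cong₂ _+_ (𝟙-no (y ∈? K) y∉K) (cong (_* q) (𝟙-no (x ≟ y) x≢y)))))

    codeg≤1 : x ∈ K → x ≢ y → codeg x y ≤ 1
    codeg≤1 {x} {y} x∈K x≢y = subst (_≤ 1)
      (sym (trans (proj₂ design x∈K y) (cong (λ e → 𝟙 (y ∈? K) + e * q) (𝟙-no (x ≟ y) x≢y))))
      (subst (_≤ 1) (sym (+-identityʳ _)) (𝟙≤1 (y ∈? K)))
      where
      𝟙≤1 : {P : Set} (P? : Dec P) → 𝟙 P? ≤ 1
      𝟙≤1 (yes _) = ≤-refl
      𝟙≤1 (no _)  = z≤n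

    join-exists : x ∈ K → y ∈ K → x ≢ y → ∃ λ u → Adj x u × Adj u y
    join-exists {x} {y} x∈K y∈K x≢y = map id common⁻
      (sum-positive (λ u → A x u * A u y) (≤-reflexive (sym (trans (proj₂ design x∈K y)
        (cong₂ _+_ (𝟙-yes (y ∈? K) y∈K) (cong (_* q) (𝟙-no (x ≟ y) x≢y)))))))

    join-unique : x ∈ K → x ≢ y → Adj x u → Adj u y → Adj x v → Adj v y → u ≡ v
    join-unique {u = u} {v = v} x∈K x≢y xu uy xv vy =
      decidable-stable (u ≟ v) λ u≢v → <⇒≱ (codeg≥2 xu uy xv vy u≢v) (codeg≤1 x∈K x≢y)

    -- Distinct `x` and `y` would be two points joined by both lines `u` and `w`.
    meet-unique : u ∈ L → u ≢ w → Adj u x → Adj x w → Adj u y → Adj y w → x ≡ y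
    meet-unique {x = x} {y = y} u∈L u≢w ux xw uy yw =
      decidable-stable (x ≟ y) λ x≢y → u≢w
        (join-unique (L⇒K u∈L ux) x≢y (Adj-sym ux) uy xw (Adj-sym yw))

    -- Double counting of the adjacent pairs between `L` and `K`: each side contains all r
    -- neighbours of every vertex of the other.
    L-size : ∣ L ∣ ≡ ∣ K ∣
    L-size = *-cancelʳ-≡ _ _ r (begin
      ∣ L ∣ * r
        ≡⟨ weigh L row ⟩
      (sum λ u → sum λ x → 𝟙 (u ∈? L) * A u x)
        ≡⟨ sum-cong-≗ (λ u → sum-cong-≗ (incidence u)) ⟩
      (sum λ u → sum λ x → 𝟙 (x ∈? K) * A u x)
        ≡⟨ ∑-comm (λ u x → 𝟙 (x ∈? K) * A u x) ⟩
      (sum λ x → sum λ u → 𝟙 (x ∈? K) * A u x)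
        ≡⟨ weigh K col ⟨
      ∣ K ∣ * r ∎)
      where
      open ≡-Reasoning
      weigh : ∀ (p : Subset n) {B : Fin n → Fin n → ℕ} → (∀ x → sum (B x) ≡ r) →
              ∣ p ∣ * r ≡ sum λ x → sum λ u → 𝟙 (x ∈? p) * B x u
      weigh p {B} B≡r = begin
        ∣ p ∣ * r                           ≡⟨ cong (_* r) (card-sum p) ⟩
        (sum λ x → 𝟙 (x ∈? p)) * r          ≡⟨ *-distribʳ-sum r (λ x → 𝟙 (x ∈? p)) ⟩
        (sum λ x → 𝟙 (x ∈? p) * r)          ≡⟨ sum-cong-≗ (λ x → cong (𝟙 (x ∈? p) *_) (sym (B≡r x))) ⟩
        (sum λ x → 𝟙 (x ∈? p) * sum (B x))  ≡⟨ sum-cong-≗ (λ x → *-distribˡ-sum (𝟙 (x ∈? p)) (B x)) ⟩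
        (sum λ x → sum λ u → 𝟙 (x ∈? p) * B x u) ∎

      incidence : ∀ u x → 𝟙 (u ∈? L) * A u x ≡ 𝟙 (x ∈? K) * A u x
      incidence u x = helper (u ∈? L) (x ∈? K) (adj? u x)
        where
        helper : (l : Dec (u ∈ L)) (k : Dec (x ∈ K)) (a : Dec (Adj u x)) → 𝟙 l * 𝟙 a ≡ 𝟙 k * 𝟙 a
        helper l         k         (no _)   = trans (*-zeroʳ (𝟙 l)) (sym (*-zeroʳ (𝟙 k)))
        helper (yes _)   (yes _)   (yes _)  = refl
        helper (yes u∈L) (no x∉K)  (yes ux) = contradiction (L⇒K u∈L ux) x∉K
        helper (no u∉L)  (yes x∈K) (yes ux) = contradiction (K⇒L x∈K (Adj-sym ux)) u∉L
        helper (no _)    (no _)    (yes _)  = refl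

    -- Here the squeeze runs the other way: uniqueness of meeting points bounds codegrees from
    -- above, and as `L` is as large as `K` the bounds add up to exactly r * r.
    dual : Design L
    dual = trans L-size (proj₁ design) , λ {u} u∈L → sum-squeeze (bound u∈L) (total u)
      where
      total : ∀ u → (sum λ w → 𝟙 (w ∈? L) + 𝟙 (u ≟ w) * q) ≤ sum (codeg u)
      total u = ≤-reflexive (begin
        (sum λ w → 𝟙 (w ∈? L) + 𝟙 (u ≟ w) * q)  ≡⟨ sum-design L u ⟩
        ∣ L ∣ + q                               ≡⟨ cong (_+ q) (trans L-size (proj₁ design)) ⟩
        suc Δ + q                               ≡⟨ trans (sum-codeg u) r*r≡ ⟨
        sum (codeg u)                           ∎)
        where open ≡-Reasoning

      single : ∀ {u w x} → u ∈ L → u ≢ w → Adj u x → Adj x w → codeg u w ≤ 1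
      single {u} {w} {x} u∈L u≢w ux xw = ≤-trans (sum-mono-≤ only) (≤-reflexive (sum-at x λ _ → 1))
        where
        only : ∀ y → A u y * A y w ≤ 𝟙 (x ≟ y) * 1
        only y with adj? u y | adj? y w
        ... | no _   | _      = z≤n
        ... | yes _  | no _   = z≤n
        ... | yes uy | yes yw = ≤-reflexive (sym (trans (*-identityʳ _)
          (𝟙-yes (x ≟ y) (meet-unique u∈L u≢w ux xw uy yw))))

      bound : ∀ {u} → u ∈ L → ∀ w → codeg u w ≤ 𝟙 (w ∈? L) + 𝟙 (u ≟ w) * q
      bound {u} u∈L w = helper (u ≟ w) (w ∈? L) (codeg u w ≤? 0)
        where
        helper : (e : Dec (u ≡ w)) (l : Dec (w ∈ L)) → Dec (codeg u w ≤ 0) →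
                 codeg u w ≤ 𝟙 l + 𝟙 e * q
        helper _          _         (yes c≡0) = ≤-trans c≡0 z≤n
        helper (yes refl) (yes _)   _         =
          ≤-reflexive (trans (codeg-self u) (cong suc (sym (+-identityʳ q))))
        helper (yes refl) (no u∉L)  _         = contradiction u∈L u∉L
        helper (no u≢w)   l         (no c≢0)
          with map id common⁻ (sum-positive (λ x → A u x * A x w) (≰⇒> c≢0)) | l
        ... | x , ux , xw | yes _  = single u∈L u≢w ux xw
        ... | x , ux , xw | no w∉L = contradiction (K⇒L (L⇒K u∈L ux) xw) w∉L

  -- A design consisting of all vertices makes any two of them have exactly one
  -- common neighbour, contrary to the friendship theorem.
  ¬design-⊤ : 2 ≤ q → {K : Subset n} → Design K → ¬ (∀ x → x ∈ K)
  ¬design-⊤ 2≤q {K} (size , codeg≡) all with prime-divisor q 2≤q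
  -- For a prime p dividing q, the order r q + 1, the row sums q + 1 and the entries 1 and q + 1 of
  -- the square are all 1 modulo p.
  ... | p , pr , divides t refl = ¬loopless A pr
    (r * t , (begin
      n                ≡⟨ ∣⊤∣≡n n ⟨
      ∣ ⊤ {n} ∣        ≡⟨ cong ∣_∣ (⊆-antisym (⊆-max K) (λ {x} _ → all x)) ⟨
      ∣ K ∣            ≡⟨ size ⟩
      suc (r * (t * p))≡⟨ cong suc (*-assoc r t p) ⟨
      suc (r * t * p)  ≡⟨ cong suc (*-comm (r * t) p) ⟩
      suc (p * (r * t)) ∎))
    (λ x → t , trans (row x) (cong suc (*-comm t p)))
    (λ x z → 𝟙 (x ≟ z) * t , (begin
      codeg x z                              ≡⟨ codeg≡ (all x) z ⟩
      𝟙 (z ∈? K) + 𝟙 (x ≟ z) * (t * p)       ≡⟨ cong₂ _+_ (𝟙-yes (z ∈? K) (all z))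
                                                  (sym (*-assoc (𝟙 (x ≟ z)) t p)) ⟩
      suc (𝟙 (x ≟ z) * t * p)                ≡⟨ cong suc (*-comm (𝟙 (x ≟ z) * t) p) ⟩
      suc (p * (𝟙 (x ≟ z) * t))              ∎))
    (λ x → A≡0 (irrefl refl))
    where open ≡-Reasoning

  module _ (connected : Connected G) {K : Subset n} (design : Design K) where

    open DesignProperties design

    spreads : ∀ {x y} → Star Adj x y → x ∈ K ⊎ x ∈ L → y ∈ K ⊎ y ∈ L
    spreads ε          x∈         = x∈
    spreads (xz ◅ path) (inj₁ x∈K) = spreads path (inj₂ (K⇒L x∈K xz))
    spreads (xz ◅ path) (inj₂ x∈L) = spreads path (inj₁ (L⇒K x∈L xz))

    -- Each edge exchanges membership in `K` and in `L`, so a vertex in both passes both on.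
    spreads-both : ∀ {x y} → Star Adj x y → x ∈ K → x ∈ L → y ∈ K
    spreads-both ε           x∈K x∈L = x∈K
    spreads-both (xz ◅ path) x∈K x∈L = spreads-both path (L⇒K x∈L xz) (K⇒L x∈K xz)

    covers : ∀ y → y ∈ K ⊎ y ∈ L
    covers y with 0<∣p∣⇒nonempty {p = K} (subst (0 <_) (sym (proj₁ design)) z<s)
    ... | x , x∈K = spreads (Connected.path connected x y) (inj₁ x∈K)

    K∩L≡∅ : 2 ≤ q → ∀ {x} → x ∈ K → ¬ (x ∈ L)
    K∩L≡∅ 2≤q {x} x∈K x∈L =
      ¬design-⊤ 2≤q design λ y → spreads-both (Connected.path connected x y) x∈K x∈L

-- Open packings and projective planes

module _ {q : ℕ} (2≤q : 2 ≤ q) (G : Graph n) (connected : Connected G) (regular : Regular (suc q) G)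
  where

  open RegularGraph G regular

  -- The projective plane of a design

  module _ {K : Subset n} (design : Design K)
    (points : Enumeration K (q ^ 2 + q + 1)) (lines : Enumeration (neighbours K) (q ^ 2 + q + 1))
    where

    open DesignProperties design

    private
      module Dual = DesignProperties dual

      order : ℕ
      order = q ^ 2 + q + 1

      Pt Ln : Fin order → Fin n
      Pt = to points
      Ln = to lines

    plane : ProjectivePlane q
    plane = record
      { _on_          = λ p l → Adj (Pt p) (Ln l)
      ; _on?_         = λ p l → adj? (Pt p) (Ln l)
      ; pointsPerLine = λ l → begin
          ∣ subsetOf (λ p → adj? (Pt p) (Ln l)) ∣  ≡⟨ card-subsetOf (λ p → adj? (Pt p) (Ln l)) ⟩
          sum (λ p → A (Pt p) (Ln l))              ≡⟨ sum-to points (λ x → A x (Ln l)) ⟩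
          sum (λ x → 𝟙 (x ∈? K) * A x (Ln l))      ≡⟨ sum-cong-≗ (λ x → absorb (x ∈? K) (adj? x (Ln l))
                                                        (λ xl → L⇒K (to-∈ lines l) (Adj-sym xl))) ⟩
          sum (λ x → A x (Ln l))                   ≡⟨ trans (col (Ln l)) (+-comm 1 q) ⟩
          q + 1                                    ∎
      ; linesPerPoint = λ p → begin
          ∣ subsetOf (λ l → adj? (Pt p) (Ln l)) ∣  ≡⟨ card-subsetOf (λ l → adj? (Pt p) (Ln l)) ⟩
          sum (λ l → A (Pt p) (Ln l))              ≡⟨ sum-to lines (A (Pt p)) ⟩
          sum (λ u → 𝟙 (u ∈? L) * A (Pt p) u)      ≡⟨ sum-cong-≗ (λ u → absorb (u ∈? L) (adj? (Pt p) u)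
                                                        (K⇒L (to-∈ points p))) ⟩
          sum (A (Pt p))                           ≡⟨ trans (row (Pt p)) (+-comm 1 q) ⟩
          q + 1                                    ∎
      ; join          = join-lines
      ; meet          = meet-points
      }
      where
      open ≡-Reasoning
      absorb : {P Q : Set} (P? : Dec P) (Q? : Dec Q) → (Q → P) → 𝟙 P? * 𝟙 Q? ≡ 𝟙 Q?
      absorb (yes _) Q?      _   = +-identityʳ (𝟙 Q?)
      absorb (no ¬p) (yes q) q⇒p = contradiction (q⇒p q) ¬p
      absorb (no _)  (no _)  _   = refl

      join-lines : ∀ p p′ → p ≢ p′ → ∃! _≡_ λ l → Adj (Pt p) (Ln l) × Adj (Pt p′) (Ln l)
      join-lines p p′ p≢p′
        with join-exists (to-∈ points p) (to-∈ points p′) (p≢p′ ∘ to-injective points)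
      ... | u , pu , up′ = index lines u∈L
        , (subst (Adj (Pt p)) (sym l≡u) pu , subst (Adj (Pt p′)) (sym l≡u) (Adj-sym up′))
        , λ (pl , p′l) → to-injective lines (trans l≡u
            (join-unique (to-∈ points p) (p≢p′ ∘ to-injective points) pu up′ pl (Adj-sym p′l)))
        where
        u∈L = K⇒L (to-∈ points p) pu
        l≡u = to-index lines u∈L

      meet-points : ∀ l l′ → l ≢ l′ → ∃! _≡_ λ p → Adj (Pt p) (Ln l) × Adj (Pt p) (Ln l′)
      meet-points l l′ l≢l′
        with Dual.join-exists (to-∈ lines l) (to-∈ lines l′) (l≢l′ ∘ to-injective lines)
      ... | x , lx , xl′ = index points x∈K
        , (subst (λ y → Adj y (Ln l)) (sym p≡x) (Adj-sym lx)
          , subst (λ y → Adj y (Ln l′)) (sym p≡x) xl′)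
        , λ (pl , pl′) → to-injective points (trans p≡x
            (Dual.join-unique (to-∈ lines l) (l≢l′ ∘ to-injective lines) lx xl′ (Adj-sym pl) pl′))
        where
        x∈K = L⇒K (to-∈ lines l) lx
        p≡x = to-index points x∈K

    private
      K⇒∉L : ∀ {x} → x ∈ K → x ∉ L
      K⇒∉L = K∩L≡∅ connected design 2≤q

      vertex : Fin order ⊎ Fin order → Fin n
      vertex = [ Pt , Ln ]′

      side : ∀ x → x ∈ K ⊎ x ∈ L
      side = covers connected design

      label : ∀ x → x ∈ K ⊎ x ∈ L → Fin order ⊎ Fin order
      label x (inj₁ x∈K) = inj₁ (index points x∈K)
      label x (inj₂ x∈L) = inj₂ (index lines x∈L)

      vertex-label : ∀ x x∈ → vertex (label x x∈) ≡ x
      vertex-label x (inj₁ x∈K) = to-index points x∈K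
      vertex-label x (inj₂ x∈L) = to-index lines x∈L

      label-vertex : ∀ i x∈ → label (vertex i) x∈ ≡ i
      label-vertex (inj₁ p) (inj₁ x∈K) = cong inj₁ (index-to points x∈K)
      label-vertex (inj₁ p) (inj₂ x∈L) = contradiction x∈L (K⇒∉L (to-∈ points p))
      label-vertex (inj₂ l) (inj₁ x∈K) = contradiction (to-∈ lines l) (K⇒∉L x∈K)
      label-vertex (inj₂ l) (inj₂ x∈L) = cong inj₂ (index-to lines x∈L)

      vertex-of : Fin (order + order) → Fin n
      vertex-of = vertex ∘ splitAt order

      label-of : Fin n → Fin (order + order)
      label-of x = join order order (label x (side x))

      vertex-label-of : ∀ x → vertex-of (label-of x) ≡ x
      vertex-label-of x =
        trans (cong vertex (splitAt-join order order (label x (side x)))) (vertex-label x (side x))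

      label-vertex-of : ∀ i → label-of (vertex-of i) ≡ i
      label-vertex-of i = trans
        (cong (join order order) (label-vertex (splitAt order i) (side (vertex-of i))))
        (join-splitAt order order i)

      preserves : ∀ i j → Adj (vertex-of i) (vertex-of j) ⇔ Graph.Adj (incidenceGraph plane) i j
      preserves i j with splitAt order i | splitAt order j
      -- Adjacent points would put one of them into `L`, which is disjoint from `K`; likewise for
      -- lines below.
      ... | inj₁ p | inj₁ p′ =
        mk⇔ (λ pp′ → K⇒∉L (to-∈ points p′) (K⇒L (to-∈ points p) pp′)) ⊥-elim
      ... | inj₁ p | inj₂ l  = mk⇔ id id
      ... | inj₂ l | inj₁ p  = mk⇔ Adj-sym Adj-sym
      ... | inj₂ l | inj₂ l′ =
        mk⇔ (λ ll′ → K⇒∉L (L⇒K (to-∈ lines l) ll′) (to-∈ lines l′)) ⊥-elim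

    ≅incidenceGraph : G ≅ incidenceGraph plane
    ≅incidenceGraph = record
      { bijection = mk↔ₛ′ label-of vertex-of label-vertex-of vertex-label-of
      ; preserves = λ u v →
          subst₂ (λ x y → Adj x y ⇔ Graph.Adj (incidenceGraph plane) (label-of u) (label-of v))
            (vertex-label-of u) (vertex-label-of v) (preserves (label-of u) (label-of v))
      }

  design⇒plane : {K : Subset n} → Design K → IsIncidenceGraphOfPlane q G
  design⇒plane {K} design = plane design points lines , ≅incidenceGraph design points lines
    where
    order≡ : ∀ q → suc (suc q * q) ≡ q * (q * 1) + q + 1
    order≡ = solve-∀

    points : Enumeration K (q ^ 2 + q + 1)
    points = subst (Enumeration K) (trans (proj₁ design) (order≡ q)) (enumerate K)

    lines : Enumeration (neighbours K) (q ^ 2 + q + 1)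
    lines = subst (Enumeration (neighbours K))
      (trans (proj₁ (DesignProperties.dual design)) (order≡ q)) (enumerate (neighbours K))

  -- Open packings as complements of dominating sets

  OpenPacking : Subset n → Set
  OpenPacking D = ∀ {v x y} → x ∈ D → y ∈ D → Adj x v → Adj y v → x ≡ y

  ∈N⁻ : ∀ {v x} → x ∈ N v → Adj x v
  ∈N⁻ {v} = ∈-subsetOf⁻ (λ u → adj? u v)

  ∈N⁺ : ∀ {v x} → Adj x v → x ∈ N v
  ∈N⁺ {v} = ∈-subsetOf⁺ (λ u → adj? u v)

  N-split : ∀ v S → suc q ≡ ∣ N v ∩ S ∣ + ∣ N v ─ S ∣
  N-split v S = trans (sym (regular v)) (card-split (N v) S)

  -- Each neighbourhood has q + 1 elements and loses at most one to `D`.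
  packing⇒dominating : ∀ {D} → OpenPacking D → TupleTotalDominating q G (∁ D)
  packing⇒dominating {D} packing v = s≤s⁻¹ (begin
    suc q                                    ≡⟨ N-split v (∁ D) ⟩
    ∣ N v ∩ ∁ D ∣ + ∣ N v ─ ∁ D ∣            ≤⟨ +-monoʳ-≤ ∣ N v ∩ ∁ D ∣ (subsingleton⇒∣p∣≤1 same) ⟩
    ∣ N v ∩ ∁ D ∣ + 1                        ≡⟨ +-comm _ 1 ⟩
    suc ∣ N v ∩ ∁ D ∣                        ∎)
    where
    open ≤-Reasoning
    same : ∀ {x y} → x ∈ N v ─ ∁ D → y ∈ N v ─ ∁ D → x ≡ y
    same x∈ y∈ with x∈p─q⁻ (N v) (∁ D) x∈ | x∈p─q⁻ (N v) (∁ D) y∈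
    ... | x∈N , x∉ | y∈N , y∉ = packing (x∉∁p⇒x∈p x∉) (x∉∁p⇒x∈p y∉) (∈N⁻ x∈N) (∈N⁻ y∈N)

  -- Two neighbours of `v` outside `S` would leave it only q - 1 inside.
  dominating⇒packing : ∀ {S} → TupleTotalDominating q G S → OpenPacking (∁ S)
  dominating⇒packing {S} dom {v} {x} {y} x∈ y∈ xv yv = decidable-stable (x ≟ y) λ x≢y →
    <⇒≱ (x,y∈p⇒1<∣p∣ (missed xv x∈) (missed yv y∈) x≢y)
        (+-cancelˡ-≤ q _ _ (begin
          q + ∣ N v ─ S ∣              ≤⟨ +-monoˡ-≤ _ (dom v) ⟩
          ∣ N v ∩ S ∣ + ∣ N v ─ S ∣    ≡⟨ N-split v S ⟨
          suc q                        ≡⟨ +-comm 1 q ⟩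
          q + 1                        ∎))
    where
    open ≤-Reasoning
    missed : ∀ {x} → Adj x v → x ∈ ∁ S → x ∈ N v ─ S
    missed xv x∈ = x∈p∧x∉q⇒x∈p─q (∈N⁺ xv) (x∈∁p⇒x∉p x∈)

  card-∁ : ∀ (p : Subset n) → ∣ ∁ p ∣ + ∣ p ∣ ≡ n
  card-∁ p = trans (cong (_+ ∣ p ∣) (∣∁p∣≡n∸∣p∣ p)) (m∸n+n≡m (∣p∣≤n p))

  dominating? : ∀ S → Dec (TupleTotalDominating q G S)
  dominating? S = all? λ v → q ≤? ∣ N v ∩ S ∣

  minimum-below : ∀ S → TupleTotalDominating q G S → Acc _<_ ∣ S ∣ →
                  ∃ (IsTupleTotalDominationNumber q G)
  minimum-below S dom (acc rec) with anySubset? (λ S′ → dominating? S′ ×-dec ∣ S′ ∣ <? ∣ S ∣)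
  ... | yes (S′ , dom′ , S′<S) = minimum-below S′ dom′ (rec S′<S)
  ... | no none = ∣ S ∣ , record
    { attained = S , dom , refl
    ; minimal  = λ S′ dom′ → ≮⇒≥ λ S′<S → none (S′ , dom′ , S′<S)
    }

  domination-number : ∃ (IsTupleTotalDominationNumber q G)
  -- The descent starts from the set of all vertices, the complement of the empty packing.
  domination-number = minimum-below (∁ ⊥)
    (packing⇒dominating λ x∈ → contradiction x∈ ∉⊥) (<-wellFounded _)

  open IsTupleTotalDominationNumber

  -- The complement of an independent set of H with at least n / Δ vertices is dominating; all is
  -- multiplied through by Δ. A large clique would make `G` the graph of a plane.
  domination-bound : ∀ {γ} → IsTupleTotalDominationNumber q G γ →
                     ¬ IsIncidenceGraphOfPlane q G → γ * Δ ≤ (Δ ∸ 1) * n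
  domination-bound {γ} isγ ¬plane
    with Independence.independence meets? meets-sym (λ (x≢x , _) → x≢x refl)
           meets-degree (meets-triangle 2≤q) ⊤ (<-wellFounded _)
  ... | inj₂ (K , clique , large) =
    contradiction (design⇒plane (clique⇒design K clique large)) ¬plane
  ... | inj₁ (I , _ , independent , large) = begin
    γ * Δ              ≡⟨ *-comm γ Δ ⟩
    Δ * γ              ≤⟨ m+n≤o⇒m≤o∸n (Δ * γ) bound ⟩
    Δ * n ∸ n          ≡⟨ cong (Δ * n ∸_) (*-identityˡ n) ⟨
    Δ * n ∸ 1 * n      ≡⟨ *-distribʳ-∸ n Δ 1 ⟨
    (Δ ∸ 1) * n        ∎
    where
    open ≤-Reasoning
    packing : OpenPacking I
    packing {v} {x} {y} x∈ y∈ xv yv = decidable-stable (x ≟ y) λ x≢y →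
      independent x∈ y∈ (x≢y , v , xv , Adj-sym yv)

    bound : Δ * γ + n ≤ Δ * n
    bound = begin
      Δ * γ + n                    ≤⟨ +-monoʳ-≤ (Δ * γ) (subst (_≤ Δ * ∣ I ∣) (∣⊤∣≡n n) large) ⟩
      Δ * γ + Δ * ∣ I ∣            ≡⟨ *-distribˡ-+ Δ γ ∣ I ∣ ⟨
      Δ * (γ + ∣ I ∣)              ≤⟨ *-monoʳ-≤ Δ (+-monoˡ-≤ ∣ I ∣
                                        (minimal isγ (∁ I) (packing⇒dominating packing))) ⟩
      Δ * (∣ ∁ I ∣ + ∣ I ∣)        ≡⟨ cong (Δ *_) (card-∁ I) ⟩
      Δ * n                        ∎

  -- Open packings in the incidence graph of a plane

  module _ (P : ProjectivePlane q) (G≅P : G ≅ incidenceGraph P) where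

    open ProjectivePlane P using (_on_) renaming (join to joinₚ; meet to meetₚ)
    open _≅_ G≅P
    open Inverse bijection using (strictlyInverseˡ; strictlyInverseʳ) renaming (to to φ; from to φ⁻¹)

    private
      order : ℕ
      order = q ^ 2 + q + 1

      kind : Fin n → Fin order ⊎ Fin order
      kind = splitAt order ∘ φ

      vertex : Fin order ⊎ Fin order → Fin n
      vertex = φ⁻¹ ∘ join order order

      kind-vertex : ∀ i → kind (vertex i) ≡ i
      kind-vertex i = trans
        (cong (splitAt order) (strictlyInverseˡ (join order order i))) (splitAt-join order order i)

      vertex-kind : ∀ x → vertex (kind x) ≡ x
      vertex-kind x = trans (cong φ⁻¹ (join-splitAt order order (φ x))) (strictlyInverseʳ x)

      adj⇒ : ∀ {x y} → Adj x y → Graph.Adj (incidenceGraph P) (φ x) (φ y)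
      adj⇒ {x} {y} = Equivalence.to (preserves x y)

      adj⇐ : ∀ {x y} → Graph.Adj (incidenceGraph P) (φ x) (φ y) → Adj x y
      adj⇐ {x} {y} = Equivalence.from (preserves x y)

      -- Adjacency in the incidence graph computes only once both values of `splitAt` are known;
      -- this keeps them as equations.
      data Bipartite (x y : Fin n) : Set where
        point-line : ∀ {p l} → kind x ≡ inj₁ p → kind y ≡ inj₂ l → Bipartite x y
        line-point : ∀ {p l} → kind x ≡ inj₂ l → kind y ≡ inj₁ p → Bipartite x y

      bipartite : ∀ {x y} → Adj x y → Bipartite x y
      bipartite {x} {y} xy with splitAt order (φ x) in ex | splitAt order (φ y) in ey | adj⇒ xy
      ... | inj₁ p | inj₂ l  | _ = point-line ex ey
      ... | inj₂ l | inj₁ p  | _ = line-point ex ey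
      ... | inj₁ p | inj₁ p′ | ()
      ... | inj₂ l | inj₂ l′ | ()

      on⇒adj : ∀ {x y p l} → kind x ≡ inj₁ p → kind y ≡ inj₂ l → p on l → Adj x y
      on⇒adj ex ey pl = adj⇐ (helper ex ey pl)
        where
        helper : ∀ {i j p l} → splitAt order i ≡ inj₁ p → splitAt order j ≡ inj₂ l → p on l →
                 Graph.Adj (incidenceGraph P) i j
        helper ei ej pl rewrite ei | ej = pl

      kind-injective : ∀ {x y} → kind x ≡ kind y → x ≡ y
      kind-injective {x} {y} eq =
        trans (sym (vertex-kind x)) (trans (cong vertex eq) (vertex-kind y))

      isPoint : Fin order ⊎ Fin order → Set
      isPoint i = ∃ λ p → i ≡ inj₁ p

      isPoint? : ∀ x → Dec (isPoint (kind x))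
      isPoint? x with kind x
      ... | inj₁ p = yes (p , refl)
      ... | inj₂ l = no λ ()

      double-order : ∀ q → (q * (q * 1) + q + 1) + (q * (q * 1) + q + 1) ≡ 2 * (suc q * q + 1)
      double-order = solve-∀

    incidenceGraph-order : n ≡ 2 * (Δ + 1)
    incidenceGraph-order = trans (↔⇒≡ bijection) (double-order q)

    -- Two points have their joining line as a common neighbour, and two lines their meeting point,
    -- so `D` has at most one of each.
    packing≤2 : ∀ {D} → OpenPacking D → ∣ D ∣ ≤ 2
    packing≤2 {D} packing = begin
      ∣ D ∣                     ≡⟨ card-split D Pts ⟩
      ∣ D ∩ Pts ∣ + ∣ D ─ Pts ∣ ≤⟨ +-mono-≤ (subsingleton⇒∣p∣≤1 same-point)
                                           (subsingleton⇒∣p∣≤1 same-line) ⟩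
      2                         ∎
      where
      open ≤-Reasoning
      Pts : Subset n
      Pts = subsetOf isPoint?

      same-point : ∀ {x y} → x ∈ D ∩ Pts → y ∈ D ∩ Pts → x ≡ y
      same-point {x} {y} x∈ y∈ with x∈p∩q⁻ D Pts x∈ | x∈p∩q⁻ D Pts y∈
      ... | x∈D , x∈P | y∈D , y∈P
        with ∈-subsetOf⁻ isPoint? x∈P | ∈-subsetOf⁻ isPoint? y∈P
      ...   | p , ex | p′ , ey with p ≟ p′
      ...     | yes refl = kind-injective (trans ex (sym ey))
      ...     | no p≢p′ with joinₚ p p′ p≢p′
      ...       | l , (pl , p′l) , _ = packing x∈D y∈D
        (on⇒adj ex (kind-vertex (inj₂ l)) pl) (on⇒adj ey (kind-vertex (inj₂ l)) p′l)

      line-kind : ∀ {x} → x ∉ Pts → ∃ λ l → kind x ≡ inj₂ l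
      line-kind {x} x∉ with kind x in eq
      ... | inj₁ p = contradiction (∈-subsetOf⁺ isPoint? (p , eq)) x∉
      ... | inj₂ l = l , refl

      same-line : ∀ {x y} → x ∈ D ─ Pts → y ∈ D ─ Pts → x ≡ y
      same-line {x} {y} x∈ y∈ with x∈p─q⁻ D Pts x∈ | x∈p─q⁻ D Pts y∈
      ... | x∈D , x∉P | y∈D , y∉P with line-kind x∉P | line-kind y∉P
      ...   | l , ex | l′ , ey with l ≟ l′
      ...     | yes refl = kind-injective (trans ex (sym ey))
      ...     | no l≢l′ with meetₚ l l′ l≢l′
      ...       | p , (pl , pl′) , _ = packing x∈D y∈D
        (Adj-sym (on⇒adj (kind-vertex (inj₁ p)) ex pl))
        (Adj-sym (on⇒adj (kind-vertex (inj₁ p)) ey pl′))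

    -- Any point and any line will do: one has only lines as neighbours, the other only points.
    packing-of-2 : ∃ λ D → OpenPacking D × 2 ≤ ∣ D ∣
    packing-of-2 = D , packing , x,y∈p⇒1<∣p∣
      (p⊆p∪q ⁅ l₀ ⁆ (x∈⁅x⁆ p₀)) (q⊆p∪q ⁅ p₀ ⁆ ⁅ l₀ ⁆ (x∈⁅x⁆ l₀))
      (λ p₀≡l₀ → case-absurd (trans (sym p₀-kind) (trans (cong kind p₀≡l₀) l₀-kind)))
      where
      i₀ : Fin order
      -- The final `+ 1` in `order` must come first before `zero` can be an index.
      i₀ = subst Fin (+-comm 1 (q ^ 2 + q)) zero
      p₀ l₀ : Fin n
      p₀ = vertex (inj₁ i₀)
      l₀ = vertex (inj₂ i₀)
      p₀-kind : kind p₀ ≡ inj₁ i₀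
      p₀-kind = kind-vertex (inj₁ i₀)
      l₀-kind : kind l₀ ≡ inj₂ i₀
      l₀-kind = kind-vertex (inj₂ i₀)

      case-absurd : ∀ {p l : Fin order} → ¬ (_≡_ {A = Fin order ⊎ Fin order} (inj₁ p) (inj₂ l))
      case-absurd ()

      D : Subset n
      D = ⁅ p₀ ⁆ ∪ ⁅ l₀ ⁆

      apart : ∀ {v} → Adj p₀ v → ¬ Adj l₀ v
      apart p₀v l₀v with bipartite p₀v | bipartite l₀v
      ... | line-point e _ | _ = case-absurd (trans (sym p₀-kind) e)
      ... | point-line _ _ | point-line e _ = case-absurd (trans (sym e) l₀-kind)
      ... | point-line _ e | line-point _ e′ = case-absurd (trans (sym e′) e)

      packing : OpenPacking D
      packing x∈ y∈ xv yv with x∈p∪q⁻ ⁅ p₀ ⁆ ⁅ l₀ ⁆ x∈ | x∈p∪q⁻ ⁅ p₀ ⁆ ⁅ l₀ ⁆ y∈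
      ... | inj₁ x∈p | inj₁ y∈p = trans (x∈⁅y⁆⇒x≡y p₀ x∈p) (sym (x∈⁅y⁆⇒x≡y p₀ y∈p))
      ... | inj₂ x∈l | inj₂ y∈l = trans (x∈⁅y⁆⇒x≡y l₀ x∈l) (sym (x∈⁅y⁆⇒x≡y l₀ y∈l))
      ... | inj₁ x∈p | inj₂ y∈l with refl ← x∈⁅y⁆⇒x≡y p₀ x∈p | refl ← x∈⁅y⁆⇒x≡y l₀ y∈l =
        contradiction yv (apart xv)
      ... | inj₂ x∈l | inj₁ y∈p with refl ← x∈⁅y⁆⇒x≡y l₀ x∈l | refl ← x∈⁅y⁆⇒x≡y p₀ y∈p =
        contradiction xv (apart yv)

    -- Minimum dominating sets are complements of maximum open packings, which have two elements
    -- here.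
    incidenceGraph-domination : ∀ {γ} → IsTupleTotalDominationNumber q G γ → γ ≡ 2 * Δ
    incidenceGraph-domination {γ} isγ = +-cancelʳ-≡ 2 _ _ (begin-equality
      γ + 2        ≡⟨ ≤-antisym upper lower ⟩
      n            ≡⟨ incidenceGraph-order ⟩
      2 * (Δ + 1)  ≡⟨ *-distribˡ-+ 2 Δ 1 ⟩
      2 * Δ + 2    ∎)
      where
      open ≤-Reasoning
      upper : γ + 2 ≤ n
      upper with packing-of-2
      ... | D , packing , 2≤D = begin
        γ + 2             ≤⟨ +-mono-≤ (minimal isγ (∁ D) (packing⇒dominating packing)) 2≤D ⟩
        ∣ ∁ D ∣ + ∣ D ∣   ≡⟨ card-∁ D ⟩
        n                 ∎

      lower : n ≤ γ + 2
      lower with attained isγ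
      ... | S , dom , refl = begin
        n                 ≡⟨ card-∁ S ⟨
        ∣ ∁ S ∣ + ∣ S ∣   ≤⟨ +-monoˡ-≤ ∣ S ∣ (packing≤2 (dominating⇒packing dom)) ⟩
        2 + ∣ S ∣         ≡⟨ +-comm 2 ∣ S ∣ ⟩
        ∣ S ∣ + 2         ∎

-- Imported here because the prefix + interferes with parsing ∣ p ∣ + ∣ q ∣.
open import Data.Integer.Base using (+_)

-- From natural numbers to rationals

private
  -- The right-hand sides are the products met when `c / 1` and `(a / d) * (b / 1)` are compared by
  -- cross-multiplication; each 1 is the denominator of an integer.
  numerators : ∀ a b c d → + (c * d) ≡ + c ℤ.* + (d * 1) × + (a * b) ≡ (+ a ℤ.* + b) ℤ.* + 1
  numerators a b c d =
    trans (cong (λ e → + (c * e)) (sym (*-identityʳ d))) (ℤ.pos-* c (d * 1)) ,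
    trans (ℤ.pos-* a b) (sym (ℤ.*-identityʳ (+ a ℤ.* + b)))

  -- Since `_/_` reduces to lowest terms, the comparison is carried out on unnormalised fractions,
  -- whose numerators and denominators are explicit.
  toℚᵘ-scaled : ∀ a d b →
                toℚᵘ ((+ a / suc d) ℚ.* (+ b / 1)) ℚᵘ.≃ mkℚᵘ (+ a) d ℚᵘ.* mkℚᵘ (+ b) 0
  toℚᵘ-scaled a d b = ℚᵘ.≃-trans (ℚ.toℚᵘ-homo-* (+ a / suc d) (+ b / 1))
    (ℚᵘ.*-cong (ℚ.toℚᵘ-fromℚᵘ (mkℚᵘ (+ a) d)) (ℚ.toℚᵘ-fromℚᵘ (mkℚᵘ (+ b) 0)))

scaled-≤ : ∀ a b c d .{{_ : NonZero d}} → c * d ≤ a * b →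
           (+ c / 1) ℚ.≤ (+ a / d) ℚ.* (+ b / 1)
scaled-≤ a b c (suc d) c*d≤a*b with numerators a b c (suc d)
... | lhs , rhs = ℚ.toℚᵘ-cancel-≤
  (ℚᵘ.≤-respˡ-≃ (ℚᵘ.≃-sym (ℚ.toℚᵘ-fromℚᵘ (mkℚᵘ (+ c) 0)))
    (ℚᵘ.≤-respʳ-≃ (ℚᵘ.≃-sym (toℚᵘ-scaled a d b))
      (*≤* (subst₂ ℤ._≤_ lhs rhs (ℤ.+≤+ c*d≤a*b)))))

scaled-≡ : ∀ a b c d .{{_ : NonZero d}} → c * d ≡ a * b →
           (+ c / 1) ≡ (+ a / d) ℚ.* (+ b / 1)
scaled-≡ a b c (suc d) c*d≡a*b with numerators a b c (suc d)
... | lhs , rhs = ℚ.toℚᵘ-injective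
  (ℚᵘ.≃-trans (ℚ.toℚᵘ-fromℚᵘ (mkℚᵘ (+ c) 0))
    (ℚᵘ.≃-trans (*≡* (trans (sym lhs) (trans (cong +_ c*d≡a*b) rhs)))
      (ℚᵘ.≃-sym (toℚᵘ-scaled a d b))))

theorem4 : ∀ (r n : ℕ) (3≤r : 3 ≤ r) (G : Graph n) → Connected G → Regular r G →
    ∃ λ γ → IsTupleTotalDominationNumber (r ∸ 1) G γ
    × (¬ IsIncidenceGraphOfPlane (r ∸ 1) G →
    (+ γ / 1) ℚ.≤
    _/_ (+ (r * (r ∸ 1) ∸ 1)) (r * (r ∸ 1)) {{r[r∸1]-nonZero 3≤r}}
    ℚ.* (+ n / 1))
    × (IsIncidenceGraphOfPlane (r ∸ 1) G →
    n ≡ 2 * (r * (r ∸ 1) + 1)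
    × (+ γ / 1) ≡ (+ (r * (r ∸ 1)) / suc (r * (r ∸ 1))) ℚ.* (+ n / 1)
    × γ ≡ 2 * (r * (r ∸ 1)))
theorem4 (suc q) n 3≤r@(s≤s 2≤q) G connected regular =
  map id (λ isγ → isγ , part-i isγ , part-ii isγ) (domination-number 2≤q G connected regular)
  where
  Δ = suc q * q

  part-i : ∀ {γ} → IsTupleTotalDominationNumber q G γ → ¬ IsIncidenceGraphOfPlane q G →
           (+ γ / 1) ℚ.≤ _/_ (+ (Δ ∸ 1)) Δ {{r[r∸1]-nonZero 3≤r}} ℚ.* (+ n / 1)
  part-i {γ} isγ ¬plane = scaled-≤ (Δ ∸ 1) n γ Δ {{r[r∸1]-nonZero 3≤r}}
    (domination-bound 2≤q G connected regular isγ ¬plane)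

  swap : ∀ d → 2 * d * suc d ≡ d * (2 * (d + 1))
  swap = solve-∀

  part-ii : ∀ {γ} → IsTupleTotalDominationNumber q G γ → IsIncidenceGraphOfPlane q G →
            n ≡ 2 * (Δ + 1) × (+ γ / 1) ≡ (+ Δ / suc Δ) ℚ.* (+ n / 1) × γ ≡ 2 * Δ
  part-ii {γ} isγ (P , G≅P) = n≡ , scaled-≡ Δ n γ (suc Δ) ratio , γ≡
    where
    n≡ = incidenceGraph-order 2≤q G connected regular P G≅P
    γ≡ = incidenceGraph-domination 2≤q G connected regular P G≅P isγ
    ratio : γ * suc Δ ≡ Δ * n
    ratio = trans (cong (_* suc Δ) γ≡) (trans (swap Δ) (cong (Δ *_) (sym n≡)))
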